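{- Let $G$ be a finite simple undirected graph with vertex set $V$, $|V|=n$, edge set $E$, $|E|=m\ge 1$, and vertex degrees $d_i$ ($i\in V$), and let $q$ be the largest eigenvalue of its signless Laplacian. Put $$\nu=\frac{n\sum_{i\in V}d_i^2}{4m^2},\qquad \epsilon=\frac{n\sum_{ij\in E}\sqrt{d_id_j}}{2m^2},\qquad \gamma=\frac{qn}{4m}.$$ Then $\nu\ge\epsilon$ and $\gamma\ge\nu$.
   Context: The signless Laplacian of $G$ is the matrix $D+A$, where $A$ is the adjacency matrix of $G$ and $D$ is the diagonal matrix of vertex degrees. Sums over $ij\in E$ run over each (unordered) edge once. The quantities $\nu,\epsilon,\gamma$ are measures of irregularity of $G$, defined for graphs with at least one edge. -}

module Defs where

open import Data.Bool.Base using (Bool; false; T; if_then_else_)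
open import Data.Fin.Base as Fin using (Fin)
open import Data.Fin.Properties as Fin using ()
open import Data.Integer.Base as ℤ using (ℤ; +_)
import Data.Integer.Properties as ℤ
open import Data.List.Base as List using (List; allFin; cartesianProduct; filter; length)
open import Data.Nat.Base as ℕ using (ℕ; zero; suc; NonZero)
import Data.Nat.Properties as ℕ
open import Data.Product.Base using (_×_; _,_; proj₁; proj₂; ∃-syntax; Σ-syntax)
open import Data.Rational.Base as ℚ using (ℚ; 0ℚ; 1ℚ; ½; mkℚ)
import Data.Rational.Properties as ℚ
open import Data.Rational.Solver using () renaming (module +-*-Solver to ℚ-Solver)
open import Data.Rational.Unnormalised.Base as ℚᵘ using (mkℚᵘ)
import Data.Rational.Unnormalised.Properties as ℚᵘ
open import Data.Sum.Base using (inj₁; inj₂)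
open import Data.Vec.Functional using (Vector; foldr)
open import Relation.Binary.PropositionalEquality
open import Relation.Nullary using (¬_; yes; no; contradiction)
open import Relation.Nullary.Decidable using (does; T?; _×-dec_)

------------------------------------------------------------------------
-- Real numbers: Cauchy sequences of rationals, considered up to _≈_.

IsCauchy : (ℕ → ℚ) → Set
IsCauchy x = ∀ e → 0ℚ ℚ.< e →
  ∃[ N ] ∀ m n → N ℕ.≤ m → N ℕ.≤ n → ℚ.∣ x m ℚ.- x n ∣ ℚ.< e

record ℝ : Set where
  constructor mkℝ
  field
    seq    : ℕ → ℚ
    cauchy : IsCauchy seq

open ℝ public

infix 4 _≈_ _≤_ _≥_

_≈_ : ℝ → ℝ → Set
x ≈ y = ∀ e → 0ℚ ℚ.< e →
  ∃[ N ] ∀ n → N ℕ.≤ n → ℚ.∣ seq x n ℚ.- seq y n ∣ ℚ.< e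

_≤_ : ℝ → ℝ → Set
x ≤ y = ∀ e → 0ℚ ℚ.< e →
  ∃[ N ] ∀ n → N ℕ.≤ n → seq x n ℚ.< seq y n ℚ.+ e

_≥_ : ℝ → ℝ → Set
x ≥ y = y ≤ x

fromℚ : ℚ → ℝ
fromℚ p = mkℝ (λ _ → p) λ e 0<e → 0 , λ _ _ _ _ →
  subst (ℚ._< e) (sym (cong ℚ.∣_∣ (ℚ.+-inverseʳ p))) 0<e

fromℕ : ℕ → ℝ
fromℕ k = fromℚ (+ k ℚ./ 1)

0ℝ 1ℝ : ℝ
0ℝ = fromℕ 0
1ℝ = fromℕ 1

private

  halves : ∀ e → ½ ℚ.* e ℚ.+ ½ ℚ.* e ≡ e
  halves e = trans (sym (ℚ.*-distribʳ-+ e ½ ½)) (ℚ.*-identityˡ e)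

  0<* : ∀ {p q} → 0ℚ ℚ.< p → 0ℚ ℚ.< q → 0ℚ ℚ.< p ℚ.* q
  0<* {p} {q} 0<p 0<q = subst (ℚ._< p ℚ.* q) (ℚ.*-zeroʳ p)
    (ℚ.*-monoʳ-<-pos p {{ℚ.positive 0<p}} 0<q)

  0<½ : 0ℚ ℚ.< ½
  0<½ = ℚ.positive⁻¹ ½

  0<1/ : ∀ {b} (0<b : 0ℚ ℚ.< b) →
         0ℚ ℚ.< ℚ.1/_ b {{ℚ.>-nonZero 0<b}}
  0<1/ {b} 0<b = ℚ.positive⁻¹ _ {{ℚ.1/pos⇒pos b {{ℚ.positive 0<b}}}}

  *-mono : ∀ {p q r s} → 0ℚ ℚ.≤ r → 0ℚ ℚ.≤ q → p ℚ.≤ q → r ℚ.≤ s →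
           p ℚ.* r ℚ.≤ q ℚ.* s
  *-mono {p} {q} {r} {s} 0≤r 0≤q p≤q r≤s = ℚ.≤-trans
    (ℚ.*-monoʳ-≤-nonNeg r {{ℚ.nonNegative 0≤r}} p≤q)
    (ℚ.*-monoˡ-≤-nonNeg q {{ℚ.nonNegative 0≤q}} r≤s)

  -- A Cauchy sequence is bounded beyond the stage N at which it is
  -- within 1 of its later terms.
  bound : (x : ℝ) → ∃[ N ] ∃[ B ] 0ℚ ℚ.< B × (∀ n → N ℕ.≤ n → ℚ.∣ seq x n ∣ ℚ.≤ B)
  bound x with N , near ← cauchy x 1ℚ (ℚ.positive⁻¹ 1ℚ) =
    N , ℚ.∣ a ∣ ℚ.+ 1ℚ , ℚ.+-mono-≤-< (ℚ.0≤∣p∣ a) (ℚ.positive⁻¹ 1ℚ) , λ n N≤n →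
      let open ℚ.≤-Reasoning in begin
        ℚ.∣ seq x n ∣                      ≡⟨ cong ℚ.∣_∣ (lem a (seq x n)) ⟩
        ℚ.∣ a ℚ.+ (seq x n ℚ.- a) ∣        ≤⟨ ℚ.∣p+q∣≤∣p∣+∣q∣ a _ ⟩
        ℚ.∣ a ∣ ℚ.+ ℚ.∣ seq x n ℚ.- a ∣    ≤⟨ ℚ.+-monoʳ-≤ ℚ.∣ a ∣
                                              (ℚ.<⇒≤ (near n N N≤n ℕ.≤-refl)) ⟩
        ℚ.∣ a ∣ ℚ.+ 1ℚ                     ∎
    where
    a = seq x N
    lem : ∀ p q → q ≡ p ℚ.+ (q ℚ.- p)
    lem = solve 2 (λ p q → q := p :+ (q :- p)) refl
      where open ℚ-Solver

  sum-close : ∀ e a b c d →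
    ℚ.∣ a ℚ.- c ∣ ℚ.< ½ ℚ.* e → ℚ.∣ b ℚ.- d ∣ ℚ.< ½ ℚ.* e →
    ℚ.∣ (a ℚ.+ b) ℚ.- (c ℚ.+ d) ∣ ℚ.< e
  sum-close e a b c d a-c b-d = begin-strict
    ℚ.∣ (a ℚ.+ b) ℚ.- (c ℚ.+ d) ∣         ≡⟨ cong ℚ.∣_∣ (lem a b c d) ⟩
    ℚ.∣ (a ℚ.- c) ℚ.+ (b ℚ.- d) ∣         ≤⟨ ℚ.∣p+q∣≤∣p∣+∣q∣ (a ℚ.- c) (b ℚ.- d) ⟩
    ℚ.∣ a ℚ.- c ∣ ℚ.+ ℚ.∣ b ℚ.- d ∣       <⟨ ℚ.+-mono-< a-c b-d ⟩
    ½ ℚ.* e ℚ.+ ½ ℚ.* e                   ≡⟨ halves e ⟩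
    e                                     ∎
    where
    open ℚ.≤-Reasoning
    lem : ∀ a b c d → (a ℚ.+ b) ℚ.- (c ℚ.+ d) ≡ (a ℚ.- c) ℚ.+ (b ℚ.- d)
    lem = solve 4 (λ a b c d → (a :+ b) :- (c :+ d) := (a :- c) :+ (b :- d)) refl
      where open ℚ-Solver

infixl 6 _+_
infixl 7 _*_ _÷_

-- The Cauchy proofs are opaque so that normalising an expression in the
-- reals does not unfold them; the underlying sequences remain transparent.
opaque

  +-cauchy : (x y : ℝ) → IsCauchy (λ n → seq x n ℚ.+ seq y n)
  +-cauchy x y e 0<e =
    let 0<e/2       = 0<* 0<½ 0<e
        (M , nearˣ) = cauchy x (½ ℚ.* e) 0<e/2
        (N , nearʸ) = cauchy y (½ ℚ.* e) 0<e/2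
    in M ℕ.⊔ N , λ m n ≤m ≤n →
      sum-close e (seq x m) (seq y m) (seq x n) (seq y n)
        (nearˣ m n (ℕ.m⊔n≤o⇒m≤o M N ≤m) (ℕ.m⊔n≤o⇒m≤o M N ≤n))
        (nearʸ m n (ℕ.m⊔n≤o⇒n≤o M N ≤m) (ℕ.m⊔n≤o⇒n≤o M N ≤n))

_+_ : ℝ → ℝ → ℝ
x + y = mkℝ (λ n → seq x n ℚ.+ seq y n) (+-cauchy x y)

private

  product-part : ∀ {b d} (0<b : 0ℚ ℚ.< b) p q → ℚ.∣ p ∣ ℚ.≤ b →
    ℚ.∣ q ∣ ℚ.< ℚ.1/_ b {{ℚ.>-nonZero 0<b}} ℚ.* d → ℚ.∣ p ℚ.* q ∣ ℚ.< d
  product-part {b} {d} 0<b p q p≤b q<d = begin-strict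
    ℚ.∣ p ℚ.* q ∣            ≡⟨ ℚ.∣p*q∣≡∣p∣*∣q∣ p q ⟩
    ℚ.∣ p ∣ ℚ.* ℚ.∣ q ∣      ≤⟨ ℚ.*-monoʳ-≤-nonNeg ℚ.∣ q ∣ {{ℚ.∣-∣-nonNeg q}} p≤b ⟩
    b ℚ.* ℚ.∣ q ∣            <⟨ ℚ.*-monoʳ-<-pos b {{ℚ.positive 0<b}} q<d ⟩
    b ℚ.* (ℚ.1/ b ℚ.* d)     ≡⟨ ℚ.*-assoc b (ℚ.1/ b) d ⟨
    (b ℚ.* ℚ.1/ b) ℚ.* d     ≡⟨ cong (ℚ._* d) (ℚ.*-inverseʳ b) ⟩
    1ℚ ℚ.* d                 ≡⟨ ℚ.*-identityˡ d ⟩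
    d                        ∎
    where
    open ℚ.≤-Reasoning
    instance b≢0 = ℚ.>-nonZero 0<b

  product-difference : ∀ a b c d →
    a ℚ.* b ℚ.- c ℚ.* d ≡ a ℚ.* (b ℚ.- d) ℚ.+ d ℚ.* (a ℚ.- c)
  product-difference = solve 4 (λ a b c d →
    a :* b :- c :* d := a :* (b :- d) :+ d :* (a :- c)) refl
    where open ℚ-Solver

  product-close : ∀ {B C} (0<B : 0ℚ ℚ.< B) (0<C : 0ℚ ℚ.< C) e a b c d →
    ℚ.∣ a ∣ ℚ.≤ B → ℚ.∣ d ∣ ℚ.≤ C →
    ℚ.∣ b ℚ.- d ∣ ℚ.< ℚ.1/_ B {{ℚ.>-nonZero 0<B}} ℚ.* (½ ℚ.* e) →
    ℚ.∣ a ℚ.- c ∣ ℚ.< ℚ.1/_ C {{ℚ.>-nonZero 0<C}} ℚ.* (½ ℚ.* e) →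
    ℚ.∣ a ℚ.* b ℚ.- c ℚ.* d ∣ ℚ.< e
  product-close 0<B 0<C e a b c d a≤B d≤C b-d a-c = begin-strict
    ℚ.∣ a ℚ.* b ℚ.- c ℚ.* d ∣                           ≡⟨ cong ℚ.∣_∣ (product-difference a b c d) ⟩
    ℚ.∣ a ℚ.* (b ℚ.- d) ℚ.+ d ℚ.* (a ℚ.- c) ∣           ≤⟨ ℚ.∣p+q∣≤∣p∣+∣q∣ (a ℚ.* (b ℚ.- d)) (d ℚ.* (a ℚ.- c)) ⟩
    ℚ.∣ a ℚ.* (b ℚ.- d) ∣ ℚ.+ ℚ.∣ d ℚ.* (a ℚ.- c) ∣     <⟨ ℚ.+-mono-<
      (product-part 0<B a (b ℚ.- d) a≤B b-d)
      (product-part 0<C d (a ℚ.- c) d≤C a-c) ⟩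
    ½ ℚ.* e ℚ.+ ½ ℚ.* e                                 ≡⟨ halves e ⟩
    e                                                   ∎
    where open ℚ.≤-Reasoning

opaque

  *-cauchy : (x y : ℝ) → IsCauchy (λ n → seq x n ℚ.* seq y n)
  *-cauchy x y e 0<e =
    let (M₁ , B , 0<B , x≤B) = bound x
        (N₁ , C , 0<C , y≤C) = bound y
        (M₂ , nearˣ) = cauchy x (ℚ.1/_ C {{ℚ.>-nonZero 0<C}} ℚ.* (½ ℚ.* e))
                                (0<* (0<1/ 0<C) (0<* 0<½ 0<e))
        (N₂ , nearʸ) = cauchy y (ℚ.1/_ B {{ℚ.>-nonZero 0<B}} ℚ.* (½ ℚ.* e))
                                (0<* (0<1/ 0<B) (0<* 0<½ 0<e))
        L   = M₁ ℕ.⊔ N₁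
        K   = M₂ ℕ.⊔ N₂
        L≤  = λ {i} (p : L ℕ.⊔ K ℕ.≤ i) → ℕ.m⊔n≤o⇒m≤o L K p
        K≤  = λ {i} (p : L ℕ.⊔ K ℕ.≤ i) → ℕ.m⊔n≤o⇒n≤o L K p
        M₁≤ = λ {i} (p : L ℕ.⊔ K ℕ.≤ i) → ℕ.m⊔n≤o⇒m≤o M₁ N₁ (L≤ p)
        N₁≤ = λ {i} (p : L ℕ.⊔ K ℕ.≤ i) → ℕ.m⊔n≤o⇒n≤o M₁ N₁ (L≤ p)
        M₂≤ = λ {i} (p : L ℕ.⊔ K ℕ.≤ i) → ℕ.m⊔n≤o⇒m≤o M₂ N₂ (K≤ p)
        N₂≤ = λ {i} (p : L ℕ.⊔ K ℕ.≤ i) → ℕ.m⊔n≤o⇒n≤o M₂ N₂ (K≤ p)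
    in L ℕ.⊔ K , λ m n ≤m ≤n →
      product-close 0<B 0<C e (seq x m) (seq y m) (seq x n) (seq y n)
        (x≤B m (M₁≤ ≤m)) (y≤C n (N₁≤ ≤n))
        (nearʸ m n (N₂≤ ≤m) (N₂≤ ≤n)) (nearˣ m n (M₂≤ ≤m) (M₂≤ ≤n))

_*_ : ℝ → ℝ → ℝ
x * y = mkℝ (λ n → seq x n ℚ.* seq y n) (*-cauchy x y)

_÷_ : ℝ → (k : ℕ) → .{{NonZero k}} → ℝ
x ÷ k = x * fromℚ (+ 1 ℚ./ k)

------------------------------------------------------------------------
-- Square roots of natural numbers

⌊√_⌋ : ℕ → ℕ
⌊√ zero ⌋  = 0
⌊√ suc k ⌋ with suc ⌊√ k ⌋ ℕ.* suc ⌊√ k ⌋ ℕ.≤? suc k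
... | yes _ = suc ⌊√ k ⌋
... | no  _ = ⌊√ k ⌋

⌊√⌋-lower : ∀ k → ⌊√ k ⌋ ℕ.* ⌊√ k ⌋ ℕ.≤ k
⌊√⌋-lower zero    = ℕ.z≤n
⌊√⌋-lower (suc k) with suc ⌊√ k ⌋ ℕ.* suc ⌊√ k ⌋ ℕ.≤? suc k
... | yes p = p
... | no  _ = ℕ.m≤n⇒m≤1+n (⌊√⌋-lower k)

⌊√⌋-upper : ∀ k → k ℕ.< suc ⌊√ k ⌋ ℕ.* suc ⌊√ k ⌋
⌊√⌋-upper zero    = ℕ.s≤s ℕ.z≤n
⌊√⌋-upper (suc k) with suc ⌊√ k ⌋ ℕ.* suc ⌊√ k ⌋ ℕ.≤? suc k
... | yes _ = ℕ.≤-<-trans (⌊√⌋-upper k)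
                (ℕ.*-mono-< (ℕ.n<1+n (suc ⌊√ k ⌋)) (ℕ.n<1+n (suc ⌊√ k ⌋)))
... | no ¬p = ℕ.≰⇒> ¬p

unit : ℕ → ℚ
unit n = + 1 ℚ./ suc n

private

  /-≤ : ∀ a m b n → a ℕ.* suc n ℕ.≤ b ℕ.* suc m →
        (+ a ℚ./ suc m) ℚ.≤ (+ b ℚ./ suc n)
  /-≤ a m b n h = ℚ.toℚᵘ-cancel-≤
    (ℚᵘ.≤-respˡ-≃ (ℚᵘ.≃-sym (ℚ.toℚᵘ-fromℚᵘ (mkℚᵘ (+ a) m)))
    (ℚᵘ.≤-respʳ-≃ (ℚᵘ.≃-sym (ℚ.toℚᵘ-fromℚᵘ (mkℚᵘ (+ b) n)))
      (ℚᵘ.*≤* (subst₂ ℤ._≤_ (ℤ.pos-* a (suc n)) (ℤ.pos-* b (suc m)) (ℤ.+≤+ h)))))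

  /-< : ∀ a m b n → a ℕ.* suc n ℕ.< b ℕ.* suc m →
        (+ a ℚ./ suc m) ℚ.< (+ b ℚ./ suc n)
  /-< a m b n h = ℚ.toℚᵘ-cancel-<
    (ℚᵘ.<-respˡ-≃ (ℚᵘ.≃-sym (ℚ.toℚᵘ-fromℚᵘ (mkℚᵘ (+ a) m)))
    (ℚᵘ.<-respʳ-≃ (ℚᵘ.≃-sym (ℚ.toℚᵘ-fromℚᵘ (mkℚᵘ (+ b) n)))
      (ℚᵘ.*<* (subst₂ ℤ._<_ (ℤ.pos-* a (suc n)) (ℤ.pos-* b (suc m)) (ℤ.+<+ h)))))

  /-* : ∀ a m b n → (+ a ℚ./ suc m) ℚ.* (+ b ℚ./ suc n) ≡ (+ (a ℕ.* b) ℚ./ (suc m ℕ.* suc n))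
  /-* a m b n = ℚ.toℚᵘ-injective (begin
    ℚ.toℚᵘ ((+ a ℚ./ suc m) ℚ.* (+ b ℚ./ suc n))
      ≈⟨ ℚ.toℚᵘ-homo-* (+ a ℚ./ suc m) (+ b ℚ./ suc n) ⟩
    ℚ.toℚᵘ (+ a ℚ./ suc m) ℚᵘ.* ℚ.toℚᵘ (+ b ℚ./ suc n)
      ≈⟨ ℚᵘ.*-cong (ℚ.toℚᵘ-fromℚᵘ (mkℚᵘ (+ a) m)) (ℚ.toℚᵘ-fromℚᵘ (mkℚᵘ (+ b) n)) ⟩
    mkℚᵘ (+ a) m ℚᵘ.* mkℚᵘ (+ b) n
      ≈⟨ ℚᵘ.*≡* (cong (ℤ._* + (suc m ℕ.* suc n)) (sym (ℤ.pos-* a b))) ⟩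
    mkℚᵘ (+ (a ℕ.* b)) (n ℕ.+ m ℕ.* suc n)
      ≈⟨ ℚ.toℚᵘ-fromℚᵘ (mkℚᵘ (+ (a ℕ.* b)) (n ℕ.+ m ℕ.* suc n)) ⟨
    ℚ.toℚᵘ (+ (a ℕ.* b) ℚ./ (suc m ℕ.* suc n)) ∎)
    where open ℚᵘ.≃-Reasoning

  /-+ : ∀ a n → (+ a ℚ./ suc n) ℚ.+ unit n ≡ (+ suc a ℚ./ suc n)
  /-+ a n = ℚ.toℚᵘ-injective (begin
    ℚ.toℚᵘ ((+ a ℚ./ suc n) ℚ.+ unit n)
      ≈⟨ ℚ.toℚᵘ-homo-+ (+ a ℚ./ suc n) (unit n) ⟩
    ℚ.toℚᵘ (+ a ℚ./ suc n) ℚᵘ.+ ℚ.toℚᵘ (unit n)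
      ≈⟨ ℚᵘ.+-cong (ℚ.toℚᵘ-fromℚᵘ (mkℚᵘ (+ a) n)) (ℚ.toℚᵘ-fromℚᵘ (mkℚᵘ (+ 1) n)) ⟩
    mkℚᵘ (+ a) n ℚᵘ.+ mkℚᵘ (+ 1) n
      ≈⟨ ℚᵘ.*≡* (begin-≡ a n) ⟩
    mkℚᵘ (+ suc a) n
      ≈⟨ ℚ.toℚᵘ-fromℚᵘ (mkℚᵘ (+ suc a) n) ⟨
    ℚ.toℚᵘ (+ suc a ℚ./ suc n) ∎)
    where
    open ℚᵘ.≃-Reasoning
    begin-≡ : ∀ a n → (+ a ℤ.* + suc n ℤ.+ + 1 ℤ.* + suc n) ℤ.* + suc n
                    ≡ + suc a ℤ.* (+ suc n ℤ.* + suc n)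
    begin-≡ a n = trans
      (cong (ℤ._* + suc n) (trans (sym (ℤ.*-distribʳ-+ (+ suc n) (+ a) (+ 1)))
        (cong (λ k → + k ℤ.* + suc n) (ℕ.+-comm a 1))))
      (ℤ.*-assoc (+ suc a) (+ suc n) (+ suc n))

  0≤/ : ∀ a n → 0ℚ ℚ.≤ (+ a ℚ./ suc n)
  0≤/ a n = /-≤ 0 0 a n ℕ.z≤n

  0≤unit : ∀ n → 0ℚ ℚ.≤ unit n
  0≤unit = 0≤/ 1

  unit-antitone : ∀ {m n} → m ℕ.≤ n → unit n ℚ.≤ unit m
  unit-antitone {m} {n} m≤n = /-≤ 1 n 1 m (ℕ.*-monoʳ-≤ 1 (ℕ.s≤s m≤n))

  archimedean : ∀ e → 0ℚ ℚ.< e → ∃[ N ] unit N ℚ.< e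
  archimedean (mkℚ (+ 0)     d c) 0<e = contradiction 0<e (λ { (ℚ.*<* (ℤ.+<+ ())) })
  archimedean (mkℚ ℤ.-[1+ _ ] d c) (ℚ.*<* ())
  archimedean e@(mkℚ (+ suc a) d c) 0<e = suc d ,
    subst (unit (suc d) ℚ.<_) (ℚ.↥p/↧p≡p e)
      (/-< 1 (suc d) (suc a) d
        (ℕ.<-≤-trans (subst (ℕ._< suc (suc d)) (sym (ℕ.*-identityˡ (suc d))) (ℕ.n<1+n (suc d)))
                     (ℕ.m≤n*m (suc (suc d)) (suc a))))

-- The largest multiple of 1/(n+1) that does not exceed √k.
√-approx : ℕ → ℕ → ℚ
√-approx k n = + ⌊√ k ℕ.* (suc n ℕ.* suc n) ⌋ ℚ./ suc n

√-approx-lower : ∀ k n → √-approx k n ℚ.* √-approx k n ℚ.≤ (+ k ℚ./ 1)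
√-approx-lower k n = subst (ℚ._≤ (+ k ℚ./ 1)) (sym (/-* s n s n))
  (/-≤ (s ℕ.* s) (n ℕ.+ n ℕ.* suc n) k 0
    (subst (ℕ._≤ k ℕ.* (suc n ℕ.* suc n)) (sym (ℕ.*-identityʳ (s ℕ.* s)))
      (⌊√⌋-lower (k ℕ.* (suc n ℕ.* suc n)))))
  where
  s : ℕ
  s = ⌊√ k ℕ.* (suc n ℕ.* suc n) ⌋

√-approx-upper : ∀ k n → (+ k ℚ./ 1) ℚ.<
  (√-approx k n ℚ.+ unit n) ℚ.* (√-approx k n ℚ.+ unit n)
√-approx-upper k n = subst ((+ k ℚ./ 1) ℚ.<_)
  (sym (trans (cong (λ z → z ℚ.* z) (/-+ s n)) (/-* (suc s) n (suc s) n)))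
  (/-< k 0 (suc s ℕ.* suc s) (n ℕ.+ n ℕ.* suc n)
    (subst (k ℕ.* (suc n ℕ.* suc n) ℕ.<_) (sym (ℕ.*-identityʳ (suc s ℕ.* suc s)))
      (⌊√⌋-upper (k ℕ.* (suc n ℕ.* suc n)))))
  where
  s : ℕ
  s = ⌊√ k ℕ.* (suc n ℕ.* suc n) ⌋

√-approx-nonNegative : ∀ k n → 0ℚ ℚ.≤ √-approx k n
√-approx-nonNegative k n = 0≤/ ⌊√ k ℕ.* (suc n ℕ.* suc n) ⌋ n

private

  square-cancel-≤ : ∀ {p q r} → 0ℚ ℚ.≤ p → 0ℚ ℚ.≤ q →
    p ℚ.* p ℚ.≤ r → r ℚ.< q ℚ.* q → p ℚ.≤ q
  square-cancel-≤ {p} {q} 0≤p 0≤q p²≤r r<q² = ℚ.≮⇒≥ λ q<p →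
    ℚ.<-irrefl refl (ℚ.<-≤-trans r<q²
      (ℚ.≤-trans (*-mono 0≤q 0≤p (ℚ.<⇒≤ q<p) (ℚ.<⇒≤ q<p)) p²≤r))

  √-approx-close : ∀ k m n → √-approx k m ℚ.≤ √-approx k n ℚ.+ unit n
  √-approx-close k m n = square-cancel-≤ (√-approx-nonNegative k m)
    (ℚ.+-mono-≤ (√-approx-nonNegative k n) (0≤unit n))
    (√-approx-lower k m) (√-approx-upper k n)

  ∣-∣-≤ : ∀ p q {e} → p ℚ.≤ q ℚ.+ e → q ℚ.≤ p ℚ.+ e → ℚ.∣ p ℚ.- q ∣ ℚ.≤ e
  ∣-∣-≤ p q {e} h₁ h₂ with ℚ.∣p∣≡p∨∣p∣≡-p (p ℚ.- q)
  ... | inj₁ eq = subst₂ ℚ._≤_ (sym eq) (lem q e) (ℚ.+-monoˡ-≤ (ℚ.- q) h₁)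
    where
    lem : ∀ q e → (q ℚ.+ e) ℚ.- q ≡ e
    lem = solve 2 (λ q e → (q :+ e) :- q := e) refl
      where open ℚ-Solver
  ... | inj₂ eq = subst₂ ℚ._≤_ (trans (lem₂ p q) (sym eq)) (lem p e) (ℚ.+-monoˡ-≤ (ℚ.- p) h₂)
    where
    open ℚ-Solver
    lem : ∀ q e → (q ℚ.+ e) ℚ.- q ≡ e
    lem = solve 2 (λ q e → (q :+ e) :- q := e) refl
    lem₂ : ∀ p q → q ℚ.- p ≡ ℚ.- (p ℚ.- q)
    lem₂ = solve 2 (λ p q → q :- p := :- (p :- q)) refl

opaque

  √-cauchy : ∀ k → IsCauchy (√-approx k)
  √-cauchy k e 0<e =
    let (N , u<e) = archimedean e 0<e in
    N , λ m n N≤m N≤n → ℚ.≤-<-trans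
      (∣-∣-≤ (√-approx k m) (√-approx k n)
        (ℚ.≤-trans (√-approx-close k m n) (ℚ.+-monoʳ-≤ (√-approx k n) (unit-antitone N≤n)))
        (ℚ.≤-trans (√-approx-close k n m) (ℚ.+-monoʳ-≤ (√-approx k m) (unit-antitone N≤m))))
      u<e

√ : ℕ → ℝ
√ k = mkℝ (√-approx k) (√-cauchy k)

√-nonNegative : ∀ k → 0ℝ ≤ √ k
√-nonNegative k e 0<e = 0 , λ n _ → ℚ.+-mono-≤-< (√-approx-nonNegative k n) 0<e

private

  square-close : ∀ a u κ c → 0ℚ ℚ.≤ u → 0ℚ ℚ.≤ c → a ℚ.* a ℚ.≤ κ →
    κ ℚ.< (a ℚ.+ u) ℚ.* (a ℚ.+ u) → (a ℚ.+ a) ℚ.+ u ℚ.≤ c →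
    ℚ.∣ a ℚ.* a ℚ.- κ ∣ ℚ.≤ u ℚ.* c
  square-close a u κ c 0≤u 0≤c lower upper 2a+u≤c = ∣-∣-≤ (a ℚ.* a) κ
    (subst (ℚ._≤ κ ℚ.+ u ℚ.* c) (ℚ.+-identityʳ (a ℚ.* a))
      (ℚ.+-mono-≤ lower (subst (ℚ._≤ u ℚ.* c) (ℚ.*-zeroʳ u)
        (ℚ.*-monoˡ-≤-nonNeg u {{ℚ.nonNegative 0≤u}} 0≤c))))
    (ℚ.≤-trans (subst (κ ℚ.≤_) (expand a u) (ℚ.<⇒≤ upper))
      (ℚ.+-monoʳ-≤ (a ℚ.* a) (ℚ.*-monoˡ-≤-nonNeg u {{ℚ.nonNegative 0≤u}} 2a+u≤c)))
    where
    expand : ∀ a u → (a ℚ.+ u) ℚ.* (a ℚ.+ u) ≡ a ℚ.* a ℚ.+ u ℚ.* ((a ℚ.+ a) ℚ.+ u)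
    expand = solve 2 (λ a u →
      (a :+ u) :* (a :+ u) := a :* a :+ u :* ((a :+ a) :+ u)) refl
      where open ℚ-Solver

  scale-< : ∀ {c e v} (0<c : 0ℚ ℚ.< c) → v ℚ.< e ℚ.* ℚ.1/_ c {{ℚ.>-nonZero 0<c}} →
            v ℚ.* c ℚ.< e
  scale-< {c} {e} {v} 0<c v<e/c = subst (v ℚ.* c ℚ.<_)
    (trans (ℚ.*-assoc e (ℚ.1/ c) c)
      (trans (cong (e ℚ.*_) (ℚ.*-inverseˡ c)) (ℚ.*-identityʳ e)))
    (ℚ.*-monoˡ-<-pos c {{ℚ.positive 0<c}} v<e/c)
    where instance c≢0 = ℚ.>-nonZero 0<c

  2√-bound : ∀ k → ∃[ c ] 0ℚ ℚ.< c × (∀ n → (√-approx k n ℚ.+ √-approx k n) ℚ.+ unit n ℚ.≤ c)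
  2√-bound k = (b ℚ.+ b) ℚ.+ 1ℚ ,
    ℚ.+-mono-≤-< (ℚ.+-mono-≤ 0≤b 0≤b) (ℚ.positive⁻¹ 1ℚ) ,
    λ n → ℚ.+-mono-≤ (ℚ.+-mono-≤ (√-approx-close k n 0) (√-approx-close k n 0))
                     (unit-antitone {0} {n} ℕ.z≤n)
    where
    b = √-approx k 0 ℚ.+ unit 0
    0≤b : 0ℚ ℚ.≤ b
    0≤b = ℚ.+-mono-≤ (√-approx-nonNegative k 0) (0≤unit 0)

  √-square-within : ∀ k e c → 0ℚ ℚ.< c →
    (∀ n → (√-approx k n ℚ.+ √-approx k n) ℚ.+ unit n ℚ.≤ c) → 0ℚ ℚ.< e →
    ∃[ N ] ∀ n → N ℕ.≤ n → ℚ.∣ √-approx k n ℚ.* √-approx k n ℚ.- (+ k ℚ./ 1) ∣ ℚ.< e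
  √-square-within k e c 0<c 2a+u≤c 0<e = N , close
    where
    arch : ∃[ N ] unit N ℚ.< e ℚ.* ℚ.1/_ c {{ℚ.>-nonZero 0<c}}
    arch = archimedean (e ℚ.* ℚ.1/_ c {{ℚ.>-nonZero 0<c}}) (0<* 0<e (0<1/ 0<c))
    N = proj₁ arch
    close : ∀ n → N ℕ.≤ n → ℚ.∣ √-approx k n ℚ.* √-approx k n ℚ.- (+ k ℚ./ 1) ∣ ℚ.< e
    close n N≤n = ℚ.≤-<-trans
      (square-close (√-approx k n) (unit n) (+ k ℚ./ 1) c (0≤unit n) (ℚ.<⇒≤ 0<c)
        (√-approx-lower k n) (√-approx-upper k n) (2a+u≤c n))
      (scale-< {c} {e} {unit n} 0<c
        (ℚ.≤-<-trans (unit-antitone {N} {n} N≤n) (proj₂ arch)))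

√-square : ∀ k → √ k * √ k ≈ fromℕ k
√-square k e 0<e = let (c , 0<c , 2a+u≤c) = 2√-bound k in
  √-square-within k e c 0<c 2a+u≤c 0<e

------------------------------------------------------------------------
-- Real vectors and matrices

∑ : ∀ {n} → Vector ℝ n → ℝ
∑ = foldr _+_ 0ℝ

Matrix : ℕ → Set
Matrix n = Vector (Vector ℝ n) n

_∙_ : ∀ {n} → Matrix n → Vector ℝ n → Vector ℝ n
(M ∙ v) i = ∑ λ j → M i j * v j

IsEigenvalue : ∀ {n} → Matrix n → ℝ → Set
IsEigenvalue {n} M t = Σ[ v ∈ Vector ℝ n ]
  ¬ (∀ i → v i ≈ 0ℝ) × (∀ i → (M ∙ v) i ≈ t * v i)

IsLargestEigenvalue : ∀ {n} → Matrix n → ℝ → Set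
IsLargestEigenvalue M q = IsEigenvalue M q × (∀ t → IsEigenvalue M t → t ≤ q)

------------------------------------------------------------------------
-- Finite simple graphs on the vertex set Fin n

record SimpleGraph (n : ℕ) : Set where
  field
    adjacent    : Fin n → Fin n → Bool
    symmetric   : ∀ i j → adjacent i j ≡ adjacent j i
    irreflexive : ∀ i → adjacent i i ≡ false

module _ {n : ℕ} (G : SimpleGraph n) where

  open SimpleGraph G

  degree : Fin n → ℕ
  degree i = length (filter (λ j → T? (adjacent i j)) (allFin n))

  -- Each unordered edge is listed once, as the pair (i , j) with i < j.
  edges : List (Fin n × Fin n)
  edges = filter (λ (i , j) → i Fin.<? j ×-dec T? (adjacent i j))
                 (cartesianProduct (allFin n) (allFin n))

  ∣E∣ : ℕ
  ∣E∣ = length edges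

  adjacencyMatrix : Matrix n
  adjacencyMatrix i j = if adjacent i j then 1ℝ else 0ℝ

  degreeMatrix : Matrix n
  degreeMatrix i j = if does (i Fin.≟ j) then fromℕ (degree i) else 0ℝ

  signlessLaplacian : Matrix n
  signlessLaplacian i j = degreeMatrix i j + adjacencyMatrix i j

  module _ .{{_ : NonZero ∣E∣}} where

    private
      instance
        m²≢0 : NonZero (∣E∣ ℕ.^ 2)
        m²≢0 = ℕ.m^n≢0 ∣E∣ 2

        4m²≢0 : NonZero (4 ℕ.* ∣E∣ ℕ.^ 2)
        4m²≢0 = ℕ.m*n≢0 4 (∣E∣ ℕ.^ 2)

        2m²≢0 : NonZero (2 ℕ.* ∣E∣ ℕ.^ 2)
        2m²≢0 = ℕ.m*n≢0 2 (∣E∣ ℕ.^ 2)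

        4m≢0 : NonZero (4 ℕ.* ∣E∣)
        4m≢0 = ℕ.m*n≢0 4 ∣E∣

    ν : ℝ
    ν = (fromℕ n * ∑ λ i → fromℕ (degree i ℕ.^ 2)) ÷ (4 ℕ.* ∣E∣ ℕ.^ 2)

    ε : ℝ
    ε = (fromℕ n * List.foldr _+_ 0ℝ
          (List.map (λ (i , j) → √ (degree i ℕ.* degree j)) edges)) ÷ (2 ℕ.* ∣E∣ ℕ.^ 2)

    γ : ℝ → ℝ
    γ q = (q * fromℕ n) ÷ (4 ℕ.* ∣E∣)

{-# OPTIONS --safe #-}

-- With D = ∑ᵢ dᵢ² and Q the signless Laplacian, ε ≤ ν is the inequality of
-- arithmetic and geometric means on each edge, since ∑_{ij ∈ E} (dᵢ + dⱼ) = D.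
-- For ν ≤ γ, the form dᵀQd is ∑_{ij ∈ E} (dᵢ + dⱼ)², which is at least D² / m by
-- Cauchy–Schwarz, so the Rayleigh quotient of d is at least D / m.
--
-- That q bounds every Rayleigh quotient is shown constructively. Gaussian
-- elimination decides over ℚ whether t I - Q is positive semidefinite, and
-- bisection turns this into a real threshold t. Over ℝ the same elimination,
-- under double negation, produces a kernel vector of t I - Q, because at the
-- threshold this matrix is neither indefinite nor bounded away from zero. Hence
-- t is not not an eigenvalue, and the double negation disappears because the
-- inequality to be proved is stable.

module Submission where

open import Algebra.Bundles using (CommutativeRing)
import Algebra.Properties.Group as GroupProperties
import Algebra.Properties.Semiring.Sum as SemiringSum
import Algebra.Solver.Ring
open import Algebra.Solver.Ring.AlmostCommutativeRing
  using (fromCommutativeRing; _-Raw-AlmostCommutative⟶_; -raw-almostCommutative⟶)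
open import Data.Bool.Base using (Bool; true; false; if_then_else_; _∧_)
open import Data.Bool.Properties using (if-float)
open import Data.Fin.Base using (Fin; zero; suc)
import Data.Fin.Properties as Fin
open import Data.Integer.Base as ℤ using (+_; -[1+_]; +<+)
import Data.Integer.Properties as ℤ
open import Data.List.Base as List
  using (List; _++_; allFin; cartesianProduct; filter; length; tabulate)
import Data.List.Properties as List
open import Data.Maybe.Base using (Maybe; just; nothing)
open import Data.Nat.Base as ℕ using (ℕ; zero; suc; NonZero)
import Data.Nat.Properties as ℕ
open import Data.Product.Base using (_×_; _,_; proj₁; proj₂; ∃-syntax)
open import Data.Rational.Base as ℚ using (ℚ; 0ℚ; 1ℚ; ½; mkℚ)
import Data.Rational.Properties as ℚ
open import Data.Rational.Solver using () renaming (module +-*-Solver to ℚ-Solver)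
open import Data.Rational.Unnormalised.Base as ℚᵘ using (mkℚᵘ)
import Data.Rational.Unnormalised.Properties as ℚᵘ
open import Data.Sum.Base using (_⊎_; inj₁; inj₂)
open import Data.Vec.Functional using (Vector)
open import Effect.Monad using (RawMonad)
open import Function.Base using (_∘_)
import Function.Identity.Effectful as Identity
open import Level using (0ℓ)
open import Relation.Binary.Definitions using (tri<; tri≈; tri>)
open import Relation.Binary.PropositionalEquality as ≡ using (_≡_; cong; cong₂; subst; subst₂)
import Relation.Binary.Reasoning.Setoid as SetoidReasoning
open import Relation.Nullary using (¬_; yes; no; does; contradiction)
open import Relation.Nullary.Decidable using (T?; dec-true; dec-false)
open import Relation.Nullary.Negation using (DoubleNegation; ¬¬-Monad; ¬¬-map)
open import Relation.Unary using (Pred; Decidable)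

-- Elimination for symmetric matrices

-- The hypothesis on `q` speaks only of exact eigenvectors, so it can be used only at a real number
-- that has one, at least up to double negation. Such a number is in general irrational although the
-- matrix has integer entries. This forces the two settings: ℚ, where the sign of a pivot is
-- decidable and the number can be located, and ℝ, where its kernel vector lives but signs are
-- undecidable. One elimination serves both, over an abstract ordered ring and with sign decisions
-- taken in a monad. The abstract ring has no inverses, so nothing is divided by a pivot;
-- complements are scaled instead, and every semidefiniteness certificate carries the accumulated
-- positive factor `s`. The definite outcome records a uniform gap `c * dot x x`. The vectors that
-- exceed the lower endpoints of the bisection change from stage to stage and need not converge, so
-- they can contradict a uniform gap, but not mere positivity at each single vector. What is finally
-- compared with `q` is the rational number D / m; a rational left side is what makes the stability
-- argument a comparison of rationals.

record OrderedAlgebra : Set₁ where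
  field
    commutativeRing : CommutativeRing 0ℓ 0ℓ
  open CommutativeRing commutativeRing public
  field
    -- Rational coefficients let the ring solver use constants such as ½ in every instance.
    morphism : CommutativeRing.rawRing ℚ.+-*-commutativeRing
                 -Raw-AlmostCommutative⟶ fromCommutativeRing commutativeRing
  open _-Raw-AlmostCommutative⟶_ morphism public using () renaming (⟦_⟧ to ι)
  field
    Pos NonNeg      : Carrier → Set
    Pos-resp        : ∀ {x y} → x ≈ y → Pos x → Pos y
    NonNeg-resp     : ∀ {x y} → x ≈ y → NonNeg x → NonNeg y
    ι-pos           : ∀ {p} → 0ℚ ℚ.< p → Pos (ι p)
    pos*pos         : ∀ {x y} → Pos x → Pos y → Pos (x * y)
    pos*nonNeg      : ∀ {x y} → Pos x → NonNeg y → NonNeg (x * y)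
    pos+nonNeg      : ∀ {x y} → Pos x → NonNeg y → Pos (x + y)
    nonNeg+nonNeg   : ∀ {x y} → NonNeg x → NonNeg y → NonNeg (x + y)
    pos⇒nonNeg      : ∀ {x} → Pos x → NonNeg x
    square-nonNeg   : ∀ x → NonNeg (x * x)

module LinearAlgebra (𝔸 : OrderedAlgebra) where

  open OrderedAlgebra 𝔸 hiding (zero)
  open SemiringSum semiring public using (sum; sum-cong-≋; *-distribˡ-sum; ∑-distrib-+; ∑-comm)
  open SetoidReasoning setoid
  open import Data.Vec.Functional using (_∷_; tail; replicate)

  private
    _≟_ : ∀ p q → Maybe (ι p ≈ ι q)
    p ≟ q with p ℚ.≟ q
    ... | yes p≡q = just (reflexive (cong (ι) p≡q))
    ... | no  _   = nothing

  module Solver = Algebra.Solver.Ring (CommutativeRing.rawRing ℚ.+-*-commutativeRing)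
    (fromCommutativeRing commutativeRing) morphism _≟_
  open Solver

  nonNeg-0 : NonNeg 0#
  nonNeg-0 = NonNeg-resp (zeroˡ 0#) (square-nonNeg 0#)

  1-pos : Pos (ι 1ℚ)
  1-pos = ι-pos (ℚ.positive⁻¹ 1ℚ)

  pos+pos : ∀ {x y} → Pos x → Pos y → Pos (x + y)
  pos+pos x>0 y>0 = pos+nonNeg x>0 (pos⇒nonNeg y>0)

  nonNeg+pos : ∀ {x y} → NonNeg x → Pos y → Pos (x + y)
  nonNeg+pos x≥0 y>0 = Pos-resp (+-comm _ _) (pos+nonNeg y>0 x≥0)

  -- Dot products and quadratic forms

  Mat : ℕ → Set
  Mat n = Vector (Vector Carrier n) n

  dot : ∀ {n} → Vector Carrier n → Vector Carrier n → Carrier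
  dot u v = sum λ i → u i * v i

  _·_ : ∀ {n} → Mat n → Vector Carrier n → Vector Carrier n
  (M · v) i = dot (M i) v

  quad : ∀ {n} → Mat n → Vector Carrier n → Carrier
  quad M v = dot v (M · v)

  Symmetric : ∀ {n} → Mat n → Set
  Symmetric M = ∀ i j → M i j ≈ M j i

  dot-cong : ∀ {n} {u u′ v v′ : Vector Carrier n} →
             (∀ i → u i ≈ u′ i) → (∀ i → v i ≈ v′ i) → dot u v ≈ dot u′ v′
  dot-cong u≈u′ v≈v′ = sum-cong-≋ λ i → *-cong (u≈u′ i) (v≈v′ i)

  dot-comm : ∀ {n} (u v : Vector Carrier n) → dot u v ≈ dot v u
  dot-comm u v = sum-cong-≋ λ i → *-comm (u i) (v i)

  dot-linear : ∀ {n} (u : Vector Carrier n) p v q w →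
               dot u (λ i → p * v i + q * w i) ≈ p * dot u v + q * dot u w
  dot-linear {zero}  u p v q w = sym (trans (+-cong (zeroʳ p) (zeroʳ q)) (+-identityʳ 0#))
  dot-linear {suc n} u p v q w = begin
    u zero * (p * v zero + q * w zero) + dot (tail u) (λ i → p * tail v i + q * tail w i)
      ≈⟨ +-congˡ (dot-linear (tail u) p (tail v) q (tail w)) ⟩
    u zero * (p * v zero + q * w zero) + (p * dot (tail u) (tail v) + q * dot (tail u) (tail w))
      ≈⟨ solve 7 (λ u p v q w x y → u :* (p :* v :+ q :* w) :+ (p :* x :+ q :* y)
                    := p :* (u :* v :+ x) :+ q :* (u :* w :+ y)) refl
           (u zero) p (v zero) q (w zero) (dot (tail u) (tail v)) (dot (tail u) (tail w)) ⟩
    p * dot u v + q * dot u w ∎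

  dot-linearˡ : ∀ {n} (u : Vector Carrier n) p v q w →
                dot (λ i → p * v i + q * w i) u ≈ p * dot v u + q * dot w u
  dot-linearˡ u p v q w = begin
    dot (λ i → p * v i + q * w i) u ≈⟨ dot-comm _ u ⟩
    dot u (λ i → p * v i + q * w i) ≈⟨ dot-linear u p v q w ⟩
    p * dot u v + q * dot u w       ≈⟨ +-cong (*-congˡ (dot-comm u v)) (*-congˡ (dot-comm u w)) ⟩
    p * dot v u + q * dot w u       ∎

  dot-scale : ∀ {n} (u : Vector Carrier n) p v → dot u (λ i → p * v i) ≈ p * dot u v
  dot-scale u p v = begin
    dot u (λ i → p * v i)       ≈⟨ sum-cong-≋ (λ i → solve 3 (λ u p v → u :* (p :* v) := p :* (u :* v)) refl (u i) p (v i)) ⟩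
    sum (λ i → p * (u i * v i)) ≈⟨ *-distribˡ-sum p (λ i → u i * v i) ⟨
    p * dot u v                 ∎

  dot-zeroʳ : ∀ {n} (u v : Vector Carrier n) → (∀ i → v i ≈ 0#) → dot u v ≈ 0#
  dot-zeroʳ {zero}  u v v≈0 = refl
  dot-zeroʳ {suc n} u v v≈0 = begin
    u zero * v zero + dot (tail u) (tail v) ≈⟨ +-cong (*-congˡ (v≈0 zero)) (dot-zeroʳ (tail u) (tail v) (v≈0 ∘ suc)) ⟩
    u zero * 0# + 0#                        ≈⟨ +-identityʳ _ ⟩
    u zero * 0#                             ≈⟨ zeroʳ _ ⟩
    0#                                      ∎

  dot-zeroˡ : ∀ {n} (u v : Vector Carrier n) → (∀ i → u i ≈ 0#) → dot u v ≈ 0#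
  dot-zeroˡ u v u≈0 = trans (dot-comm u v) (dot-zeroʳ v u u≈0)

  quad-scale : ∀ {n} (M : Mat n) p x → quad M (λ i → p * x i) ≈ p * (p * quad M x)
  quad-scale M p x = begin
    dot (λ i → p * x i) (M · (λ i → p * x i))
      ≈⟨ dot-cong (λ _ → refl) (λ i → dot-scale (M i) p x) ⟩
    dot (λ i → p * x i) (λ i → p * (M · x) i)
      ≈⟨ trans (dot-scale _ p (M · x)) (*-congˡ (dot-comm _ (M · x))) ⟩
    p * dot (M · x) (λ i → p * x i)
      ≈⟨ *-congˡ (trans (dot-scale _ p x) (*-congˡ (dot-comm (M · x) x))) ⟩
    p * (p * quad M x) ∎

  dot-nonNeg : ∀ {n} (u : Vector Carrier n) → NonNeg (dot u u)
  dot-nonNeg {zero}  u = nonNeg-0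
  dot-nonNeg {suc n} u = nonNeg+nonNeg (square-nonNeg (u zero)) (dot-nonNeg (tail u))

  minor : ∀ {n} → Mat (suc n) → Mat n
  minor M i j = M (suc i) (suc j)

  quad-suc : ∀ {n} (M : Mat (suc n)) → Symmetric M → ∀ x →
    quad M x ≈ (M zero zero * (x zero * x zero)
      + (x zero * dot (tail (M zero)) (tail x) + x zero * dot (tail (M zero)) (tail x)))
      + quad (minor M) (tail x)
  quad-suc M M-sym x = begin
    x₀ * (a * x₀ + dot b y) + dot y (λ i → M (suc i) zero * x₀ + (C · y) i)
      ≈⟨ +-congˡ (dot-cong (λ _ → refl) λ i → trans
           (+-congʳ (*-congʳ (M-sym (suc i) zero)))
           (solve 3 (λ b x c → b :* x :+ c := x :* b :+ con 1ℚ :* c) refl (b i) x₀ ((C · y) i))) ⟩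
    x₀ * (a * x₀ + dot b y) + dot y (λ i → x₀ * b i + ι 1ℚ * (C · y) i)
      ≈⟨ +-congˡ (trans (dot-linear y x₀ b (ι 1ℚ) (C · y)) (+-congʳ (*-congˡ (dot-comm y b)))) ⟩
    x₀ * (a * x₀ + dot b y) + (x₀ * dot b y + ι 1ℚ * quad C y)
      ≈⟨ solve 4 (λ x a β q → x :* (a :* x :+ β) :+ (x :* β :+ con 1ℚ :* q)
                   := (a :* (x :* x) :+ (x :* β :+ x :* β)) :+ q) refl x₀ a (dot b y) (quad C y) ⟩
    (a * (x₀ * x₀) + (x₀ * dot b y + x₀ * dot b y)) + quad C y ∎
    where
    x₀ = x zero
    a = M zero zero
    b = tail (M zero)
    C = minor M
    y = tail x

  -- The Schur complement of the upper left entry, multiplied by that entry so that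
  -- no division occurs.
  schur : ∀ {n} → Mat (suc n) → Mat n
  schur M i j = M zero zero * M (suc i) (suc j) + (- M zero (suc i)) * M zero (suc j)

  schur-symmetric : ∀ {n} {M : Mat (suc n)} → Symmetric M → Symmetric (schur M)
  schur-symmetric {M = M} M-sym i j = +-cong (*-congˡ (M-sym (suc i) (suc j)))
    (solve 2 (λ b c → :- b :* c := :- c :* b) refl (M zero (suc i)) (M zero (suc j)))

  schur-· : ∀ {n} (M : Mat (suc n)) y i →
    (schur M · y) i ≈ M zero zero * (minor M · y) i + (- M zero (suc i)) * dot (tail (M zero)) y
  schur-· M y i = dot-linearˡ y (M zero zero) (minor M i) (- M zero (suc i)) (tail (M zero))

  quad-schur : ∀ {n} (M : Mat (suc n)) y →
    quad (schur M) y ≈ M zero zero * quad (minor M) y - dot (tail (M zero)) y * dot (tail (M zero)) y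
  quad-schur M y = begin
    dot y (schur M · y)
      ≈⟨ dot-cong (λ _ → refl) (λ i → trans (schur-· M y i)
           (solve 4 (λ a c b β → a :* c :+ :- b :* β := a :* c :+ :- β :* b) refl a ((C · y) i) (b i) β)) ⟩
    dot y (λ i → a * (C · y) i + (- β) * b i)
      ≈⟨ trans (dot-linear y a (C · y) (- β) b) (+-congˡ (*-congˡ (dot-comm y b))) ⟩
    a * quad C y + (- β) * β
      ≈⟨ solve 3 (λ a q β → a :* q :+ :- β :* β := a :* q :- β :* β) refl a (quad C y) β ⟩
    a * quad C y - β * β ∎
    where
    a = M zero zero
    b = tail (M zero)
    C = minor M
    β = dot b y

  complete-square : ∀ {n} (M : Mat (suc n)) → Symmetric M → ∀ x →
    M zero zero * quad M x ≈
      (M zero zero * x zero + dot (tail (M zero)) (tail x)) * (M zero zero * x zero + dot (tail (M zero)) (tail x))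
      + quad (schur M) (tail x)
  complete-square M M-sym x = begin
    a * quad M x
      ≈⟨ *-congˡ (quad-suc M M-sym x) ⟩
    a * ((a * (x₀ * x₀) + (x₀ * β + x₀ * β)) + q)
      ≈⟨ solve 4 (λ a x β q → a :* ((a :* (x :* x) :+ (x :* β :+ x :* β)) :+ q)
                   := (a :* x :+ β) :* (a :* x :+ β) :+ (a :* q :- β :* β)) refl a x₀ β q ⟩
    (a * x₀ + β) * (a * x₀ + β) + (a * q - β * β)
      ≈⟨ +-congˡ (quad-schur M (tail x)) ⟨
    (a * x₀ + β) * (a * x₀ + β) + quad (schur M) (tail x) ∎
    where
    x₀ = x zero
    a = M zero zero
    β = dot (tail (M zero)) (tail x)
    q = quad (minor M) (tail x)

  -- A crude Cauchy-Schwarz inequality, by induction from (b₀ y₀ + β)² ≤ 2 b₀² y₀² + 2 β². Starting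
  -- from 1 keeps the constant positive even for b = 0, so the sign of `b` is never inspected.
  dot-bound : ∀ {n} (b : Vector Carrier n) →
    ∃[ K ] Pos K × (∀ y → NonNeg (K * dot y y - dot b y * dot b y))
  dot-bound {zero}  b = ι 1ℚ , 1-pos , λ y → NonNeg-resp
    (trans (sym (zeroˡ _)) (solve 2 (λ K o → o :* (K :- o) := K :* o :- o :* o) refl (ι 1ℚ) 0#)) nonNeg-0
  dot-bound {suc n} b with K , K>0 , bound ← dot-bound (tail b) =
    (b₀ * b₀ + b₀ * b₀) + (K + K) ,
    nonNeg+pos (nonNeg+nonNeg (square-nonNeg b₀) (square-nonNeg b₀)) (pos+pos K>0 K>0) ,
    λ y → let β = dot (tail b) (tail y); Y = dot (tail y) (tail y); y₀ = y zero in
      NonNeg-resp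
        (solve 5 (λ b K y β Y →
            (((b :* y :- β) :* (b :* y :- β) :+ ((K :* Y :- β :* β) :+ (K :* Y :- β :* β)))
              :+ (K :* (y :* y) :+ K :* (y :* y))) :+ (b :* (b :* Y) :+ b :* (b :* Y))
            := ((b :* b :+ b :* b) :+ (K :+ K)) :* (y :* y :+ Y) :- (b :* y :+ β) :* (b :* y :+ β))
          refl b₀ K y₀ β Y)
        (nonNeg+nonNeg (nonNeg+nonNeg (nonNeg+nonNeg (square-nonNeg _)
            (nonNeg+nonNeg (bound (tail y)) (bound (tail y))))
          (let p = pos*nonNeg K>0 (square-nonNeg y₀) in nonNeg+nonNeg p p))
          (let p = scaled-nonNeg (tail y) in nonNeg+nonNeg p p))
    where
    b₀ = b zero
    scaled-nonNeg : ∀ {m} (u : Vector Carrier m) → NonNeg (b₀ * (b₀ * dot u u))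
    scaled-nonNeg u = NonNeg-resp
      (trans (dot-scale (λ i → b₀ * u i) b₀ u) (*-congˡ (trans (dot-comm _ u) (dot-scale u b₀ u))))
      (dot-nonNeg (λ i → b₀ * u i))

  -- In the block form a x₀² + 2 x₀ β + q, the cross term is at most x₀² + β² and β² ≤ K |y|². The
  -- corner satisfies a ≤ a² + 1, because a² - a + 1 = (a - ½)² + ¾; this takes the place of an
  -- absolute value. The result is the initial upper endpoint of the bisection.
  quad-bound : ∀ {n} (M : Mat n) → Symmetric M →
    ∃[ h ] Pos h × (∀ x → NonNeg (h * dot x x - quad M x))
  quad-bound {zero}  M M-sym = ι 1ℚ , 1-pos , λ x → NonNeg-resp
    (trans (sym (zeroˡ _)) (solve 1 (λ o → o :* (con 1ℚ :- con 1ℚ) := con 1ℚ :* o :- o) refl 0#)) nonNeg-0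
  quad-bound {suc n} M M-sym
    with K , K>0 , b-bound ← dot-bound (tail (M zero))
       | h , h>0 , C-bound ← quad-bound (minor M) (λ i j → M-sym (suc i) (suc j)) =
    (K + h) + (a * a + ι 2ℚ) ,
    pos+pos (pos+pos K>0 h>0) E>0 ,
    λ x → let y = tail x; x₀ = x zero; β = dot (tail (M zero)) y; Y = dot y y; q = quad (minor M) y in
      NonNeg-resp
        (trans (solve 7 (λ a K h x β Y q →
            ((((x :- β) :* (x :- β) :+ (K :* Y :- β :* β)) :+ ((h :* Y :- q) :+ (K :+ h) :* (x :* x)))
              :+ (((a :- con ½) :* x) :* ((a :- con ½) :* x) :+ con ¾ :* (x :* x)))
              :+ (a :* a :+ con 2ℚ) :* Y
            := ((K :+ h) :+ (a :* a :+ con 2ℚ)) :* (x :* x :+ Y)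
               :- ((a :* (x :* x) :+ (x :* β :+ x :* β)) :+ q)) refl a K h x₀ β Y q)
          (+-congˡ (-‿cong (sym (quad-suc M M-sym x)))))
        (nonNeg+nonNeg (nonNeg+nonNeg (nonNeg+nonNeg
            (nonNeg+nonNeg (square-nonNeg _) (b-bound y))
            (nonNeg+nonNeg (C-bound y) (pos*nonNeg (pos+pos K>0 h>0) (square-nonNeg x₀))))
            (nonNeg+nonNeg (square-nonNeg _) (pos*nonNeg (ι-pos (ℚ.positive⁻¹ ¾)) (square-nonNeg x₀))))
          (pos*nonNeg E>0 (dot-nonNeg y)))
    where
    a = M zero zero
    2ℚ = 1ℚ ℚ.+ 1ℚ
    ¾ = ½ ℚ.+ ½ ℚ.* ½
    E>0 : Pos (a * a + ι 2ℚ)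
    E>0 = nonNeg+pos (square-nonNeg a) (ι-pos (ℚ.positive⁻¹ 2ℚ))

  -- Each outcome is a certificate over the ring: a vector on which the form is negative,
  -- semidefiniteness together with a nonzero kernel vector, or a lower bound with an explicit gap.
  -- Nonzero vectors are given by a positive squared norm, which over ℝ says more than not being
  -- zero.
  data Definiteness {n} (M : Mat n) : Set where
    negative   : ∀ x → Pos (- quad M x) → Definiteness M
    degenerate : ∀ s → Pos s → (∀ x → NonNeg (s * quad M x)) →
                 ∀ v → Pos (dot v v) → (∀ i → (M · v) i ≈ 0#) → Definiteness M
    definite   : ∀ s c → Pos s → Pos c → (∀ x → NonNeg (s * quad M x - c * dot x x)) → Definiteness M

  private

    -- The lift (-β, a y) makes the square a x₀ + b · (a y) in `complete-square` vanish, so on it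
    -- the form of `M` is a times the form of the Schur complement at y.
    negative-schur : ∀ {n} (M : Mat (suc n)) → Symmetric M → Pos (M zero zero) →
      ∀ y → Pos (- quad (schur M) y) → Definiteness M
    negative-schur M M-sym a>0 y S<0 = negative x (Pos-resp eq (pos*pos a>0 S<0))
      where
      a = M zero zero
      b = tail (M zero)
      β = dot b y
      x = (- β) ∷ (λ i → a * y i)
      q = quad (minor M) y
      eq : a * (- quad (schur M) y) ≈ - quad M x
      eq = begin
        a * (- quad (schur M) y)
          ≈⟨ *-congˡ (-‿cong (quad-schur M y)) ⟩
        a * (- (a * q - β * β))
          ≈⟨ solve 3 (λ a q β → a :* (:- (a :* q :- β :* β)) :=
               :- ((a :* (:- β :* :- β) :+ (:- β :* (a :* β) :+ :- β :* (a :* β))) :+ a :* (a :* q)))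
               refl a q β ⟩
        - ((a * (- β * - β) + (- β * (a * β) + - β * (a * β))) + a * (a * q))
          ≈⟨ -‿cong (+-cong (+-congˡ (+-cong (*-congˡ (dot-scale b a y)) (*-congˡ (dot-scale b a y)))) (quad-scale (minor M) a y)) ⟨
        - ((a * (- β * - β) + (- β * dot b (tail x) + - β * dot b (tail x))) + quad (minor M) (tail x))
          ≈⟨ -‿cong (quad-suc M M-sym x) ⟨
        - quad M x ∎

    -- The same lift (-β, a w) carries the kernel of the Schur complement into the kernel of `M`:
    -- the first coordinate cancels, and the others reproduce `schur M · w`.
    degenerate-schur : ∀ {n} (M : Mat (suc n)) → Symmetric M → Pos (M zero zero) →
      ∀ s → Pos s → (∀ y → NonNeg (s * quad (schur M) y)) →
      ∀ w → Pos (dot w w) → (∀ i → (schur M · w) i ≈ 0#) → Definiteness M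
    degenerate-schur M M-sym a>0 s s>0 S≥0 w w≠0 Sw≈0 =
      degenerate (s * a) (pos*pos s>0 a>0) M≥0 v v≠0 Mv≈0
      where
      a = M zero zero
      b = tail (M zero)
      β = dot b w
      v = (- β) ∷ (λ i → a * w i)
      M≥0 : ∀ x → NonNeg ((s * a) * quad M x)
      M≥0 x = NonNeg-resp
        (trans (sym (distribˡ s _ _)) (trans (*-congˡ (sym (complete-square M M-sym x))) (sym (*-assoc s a _))))
        (nonNeg+nonNeg (pos*nonNeg s>0 (square-nonNeg _)) (S≥0 (tail x)))
      v≠0 : Pos (dot v v)
      v≠0 = nonNeg+pos (square-nonNeg (- β)) (Pos-resp
        (sym (trans (dot-scale _ a w) (*-congˡ (trans (dot-comm _ w) (dot-scale w a w)))))
        (pos*pos a>0 (pos*pos a>0 w≠0)))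
      Mv≈0 : ∀ i → (M · v) i ≈ 0#
      Mv≈0 zero = begin
        a * - β + dot b (λ i → a * w i) ≈⟨ +-congˡ (dot-scale b a w) ⟩
        a * - β + a * β                 ≈⟨ distribˡ a (- β) β ⟨
        a * (- β + β)                   ≈⟨ *-congˡ (-‿inverseˡ β) ⟩
        a * 0#                          ≈⟨ zeroʳ a ⟩
        0#                              ∎
      Mv≈0 (suc i) = begin
        M (suc i) zero * - β + dot (minor M i) (λ j → a * w j)
          ≈⟨ +-cong (*-congʳ (M-sym (suc i) zero)) (dot-scale (minor M i) a w) ⟩
        b i * - β + a * (minor M · w) i
          ≈⟨ solve 4 (λ b β a c → b :* :- β :+ a :* c := a :* c :+ :- b :* β) refl (b i) β a ((minor M · w) i) ⟩
        a * (minor M · w) i + (- b i) * β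
          ≈⟨ schur-· M w i ⟨
        (schur M · w) i
          ≈⟨ Sw≈0 i ⟩
        0# ∎

    definite-schur : ∀ {n} (M : Mat (suc n)) → Symmetric M → Pos (M zero zero) →
      ∀ s c → Pos s → Pos c → (∀ y → NonNeg (s * quad (schur M) y - c * dot y y)) → Definiteness M
    definite-schur M M-sym a>0 s c s>0 c>0 S≥c with K , K>0 , bound ← dot-bound (tail (M zero)) =
      definite (T * (s * a)) ((c * s) * (a * a))
        (pos*pos T>0 (pos*pos s>0 a>0)) (pos*pos cs>0 (pos*pos a>0 a>0)) M≥c
      where
      a = M zero zero
      b = tail (M zero)
      -- With u = a x₀ + β one has a² x₀² = (u - β)² = 2 u² + 2 β² - (u + β)², where β² ≤ K Y.
      -- Charging c s a² (x₀² + Y) against T (s u² + s Q) with s Q ≥ c Y leaves (T - 2 c) s u² and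
      -- (T c - c R) Y. The choice T = 2 c + R turns these into R s u² and 2 c² Y, both nonnegative.
      R = (K * s + K * s) + s * (a * a)
      T = (c + c) + R
      cs>0 = pos*pos c>0 s>0
      R>0 : Pos R
      R>0 = pos+pos (pos+pos (pos*pos K>0 s>0) (pos*pos K>0 s>0)) (pos*pos s>0 (pos*pos a>0 a>0))
      T>0 : Pos T
      T>0 = pos+pos (pos+pos c>0 c>0) R>0
      M≥c : ∀ x → NonNeg ((T * (s * a)) * quad M x - ((c * s) * (a * a)) * dot x x)
      M≥c x = NonNeg-resp eq
        (nonNeg+nonNeg (nonNeg+nonNeg
            (pos*nonNeg T>0 (S≥c y))
            (pos*nonNeg cs>0 (square-nonNeg (u + β))))
          (nonNeg+nonNeg
            (pos*nonNeg (pos+pos cs>0 cs>0) (bound y))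
            (nonNeg+nonNeg (pos*nonNeg (pos*pos R>0 s>0) (square-nonNeg u))
              (pos*nonNeg (pos+pos (pos*pos c>0 c>0) (pos*pos c>0 c>0)) (dot-nonNeg y)))))
        where
        x₀ = x zero
        y = tail x
        β = dot b y
        Y = dot y y
        u = a * x₀ + β
        Q = quad (schur M) y
        eq : (T * (s * Q - c * Y) + (c * s) * ((u + β) * (u + β)))
             + (((c * s + c * s)) * (K * Y - β * β) + ((R * s) * (u * u) + (c * c + c * c) * Y))
             ≈ (T * (s * a)) * quad M x - ((c * s) * (a * a)) * dot x x
        eq = begin
          _ ≈⟨ solve 8 (λ a s c K x β Y Q →
                let u = a :* x :+ β; R = (K :* s :+ K :* s) :+ s :* (a :* a); T = (c :+ c) :+ R in
                (T :* (s :* Q :- c :* Y) :+ (c :* s) :* ((u :+ β) :* (u :+ β)))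
                :+ (((c :* s :+ c :* s)) :* (K :* Y :- β :* β) :+ ((R :* s) :* (u :* u) :+ (c :* c :+ c :* c) :* Y))
                := T :* (s :* (u :* u :+ Q)) :- ((c :* s) :* (a :* a)) :* (x :* x :+ Y)) refl a s c K x₀ β Y Q ⟩
          T * (s * (u * u + Q)) - ((c * s) * (a * a)) * dot x x
            ≈⟨ +-congʳ (*-congˡ (*-congˡ (complete-square M M-sym x))) ⟨
          T * (s * (a * quad M x)) - ((c * s) * (a * a)) * dot x x
            ≈⟨ +-congʳ (trans (*-congˡ (sym (*-assoc s a _))) (sym (*-assoc T (s * a) _))) ⟩
          (T * (s * a)) * quad M x - ((c * s) * (a * a)) * dot x x ∎

    negative-diagonal : ∀ {n} (M : Mat (suc n)) → Symmetric M → Pos (- M zero zero) → Definiteness M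
    negative-diagonal M M-sym a<0 = negative e (Pos-resp eq a<0)
      where
      a = M zero zero
      b = tail (M zero)
      e = ι 1ℚ ∷ replicate _ 0#
      eq : - a ≈ - quad M e
      eq = -‿cong (begin
        a ≈⟨ solve 1 (λ a → a := a :* (con 1ℚ :* con 1ℚ)) refl a ⟩
        a * (ι 1ℚ * ι 1ℚ)
          ≈⟨ trans (+-identityʳ _) (+-identityʳ _) ⟨
        (a * (ι 1ℚ * ι 1ℚ) + 0#) + 0#
          ≈⟨ +-cong (+-congˡ (trans (+-cong bz bz) (+-identityʳ _))) (dot-zeroˡ (tail e) (minor M · tail e) λ _ → refl) ⟨
        (a * (ι 1ℚ * ι 1ℚ) + (ι 1ℚ * dot b (tail e) + ι 1ℚ * dot b (tail e))) + quad (minor M) (tail e)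
          ≈⟨ quad-suc M M-sym e ⟨
        quad M e ∎)
        where
        bz : ι 1ℚ * dot b (tail e) ≈ 0#
        bz = trans (*-congˡ (dot-zeroʳ b (tail e) λ _ → refl)) (zeroʳ _)

    -- With a vanishing corner a, the form is 2 x₀ (b · y) + C(y), which is
    -- unbounded below in x₀ for y a positive multiple of b.
    negative-border : ∀ {n} (M : Mat (suc n)) → Symmetric M → M zero zero ≈ 0# →
      Pos (dot (tail (M zero)) (tail (M zero))) → Definiteness M
    negative-border M M-sym a≈0 B>0 = negative x (Pos-resp eq (pos*pos B>0 B>0))
      where
      a = M zero zero
      b = tail (M zero)
      B = dot b b
      k = quad (minor M) b
      -- On (x₀, B b) the form is 2 x₀ B² + B² k; this x₀ makes it exactly -B².
      x₀ = - (ι ½ * (k + ι 1ℚ))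
      x = x₀ ∷ (λ i → B * b i)
      eq : B * B ≈ - quad M x
      eq = begin
        B * B
          ≈⟨ solve 2 (λ B k → let x = :- (con ½ :* (k :+ con 1ℚ)) in
               B :* B := :- ((x :* (B :* B) :+ x :* (B :* B)) :+ B :* (B :* k))) refl B k ⟩
        - ((x₀ * (B * B) + x₀ * (B * B)) + B * (B * k))
          ≈⟨ -‿cong (+-cong
               (trans (+-congʳ (trans (*-congʳ a≈0) (zeroˡ _))) (trans (+-identityˡ _)
                 (+-cong (*-congˡ (dot-scale b B b)) (*-congˡ (dot-scale b B b)))))
               (quad-scale (minor M) B b)) ⟨
        - ((a * (x₀ * x₀) + (x₀ * dot b (tail x) + x₀ * dot b (tail x))) + quad (minor M) (tail x))
          ≈⟨ -‿cong (quad-suc M M-sym x) ⟨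
        - quad M x ∎

    quad-borderless : ∀ {n} (M : Mat (suc n)) → Symmetric M → M zero zero ≈ 0# →
      (∀ j → M zero (suc j) ≈ 0#) → ∀ x → quad M x ≈ quad (minor M) (tail x)
    quad-borderless M M-sym a≈0 b≈0 x = begin
      quad M x
        ≈⟨ quad-suc M M-sym x ⟩
      (M zero zero * (x zero * x zero) + (x zero * β + x zero * β)) + quad (minor M) (tail x)
        ≈⟨ +-congʳ (+-cong (trans (*-congʳ a≈0) (zeroˡ _)) (trans (+-cong xβ xβ) (+-identityʳ 0#))) ⟩
      (0# + 0#) + quad (minor M) (tail x)
        ≈⟨ trans (+-congʳ (+-identityʳ 0#)) (+-identityˡ _) ⟩
      quad (minor M) (tail x) ∎
      where
      β = dot (tail (M zero)) (tail x)
      xβ : x zero * β ≈ 0#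
      xβ = trans (*-congˡ (dot-zeroˡ (tail (M zero)) (tail x) b≈0)) (zeroʳ _)

    -- The first unit vector now lies in the kernel, so even a definite minor yields the degenerate
    -- outcome, and the kernel vector of a degenerate minor can be replaced by it.
    borderless : ∀ {n} (M : Mat (suc n)) → Symmetric M → M zero zero ≈ 0# →
      (∀ j → M zero (suc j) ≈ 0#) → Definiteness (minor M) → Definiteness M
    borderless M M-sym a≈0 b≈0 = λ where
        (negative y C<0) → negative (0# ∷ y) (Pos-resp (-‿cong (sym (q (0# ∷ y)))) C<0)
        (degenerate s s>0 C≥0 _ _ _) → degenerate s s>0
          (λ x → NonNeg-resp (*-congˡ (sym (q x))) (C≥0 (tail x))) e e≠0 Me≈0
        (definite s c s>0 c>0 C≥c) → degenerate s s>0
          (λ x → NonNeg-resp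
            (trans (+-assoc _ _ _) (trans (+-congˡ (-‿inverseˡ _)) (trans (+-identityʳ _) (*-congˡ (sym (q x))))))
            (nonNeg+nonNeg (C≥c (tail x)) (pos*nonNeg c>0 (dot-nonNeg (tail x))))) e e≠0 Me≈0
      where
      q = quad-borderless M M-sym a≈0 b≈0
      e = ι 1ℚ ∷ replicate _ 0#
      e≠0 : Pos (dot e e)
      e≠0 = pos+nonNeg (pos*pos 1-pos 1-pos) (dot-nonNeg (tail e))
      column≈0 : ∀ i → M i zero ≈ 0#
      column≈0 zero    = a≈0
      column≈0 (suc i) = trans (M-sym (suc i) zero) (b≈0 i)
      Me≈0 : ∀ i → (M · e) i ≈ 0#
      Me≈0 i = trans (+-cong (trans (*-congʳ (column≈0 i)) (zeroˡ _))
                             (dot-zeroʳ (tail (M i)) (tail e) (λ _ → refl)))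
                     (+-identityʳ 0#)

  -- The monad is the identity where signs are decidable, and double negation
  -- where they are not.
  module Elimination {F : Set → Set} (monad : RawMonad F)
    (sign : ∀ a → F (Pos a ⊎ a ≈ 0# ⊎ Pos (- a))) where

    open RawMonad monad

    zero? : ∀ {n} (b : Vector Carrier n) → F ((∀ i → b i ≈ 0#) ⊎ Pos (dot b b))
    zero? {zero}  b = pure (inj₁ λ ())
    zero? {suc n} b = sign (b zero) >>= λ where
      (inj₁ b₀>0)        → pure (inj₂ (pos+nonNeg (pos*pos b₀>0 b₀>0) (dot-nonNeg (tail b))))
      (inj₂ (inj₂ b₀<0)) → pure (inj₂ (pos+nonNeg
        (Pos-resp (solve 1 (λ b → :- b :* :- b := b :* b) refl (b zero)) (pos*pos b₀<0 b₀<0))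
        (dot-nonNeg (tail b))))
      (inj₂ (inj₁ b₀≈0)) → zero? (tail b) >>= λ where
        (inj₁ b≈0) → pure (inj₁ λ { zero → b₀≈0 ; (suc i) → b≈0 i })
        (inj₂ b≠0) → pure (inj₂ (nonNeg+pos (square-nonNeg (b zero)) b≠0))

    definiteness : ∀ {n} (M : Mat n) → Symmetric M → F (Definiteness M)
    definiteness {zero}  M M-sym = pure (definite (ι 1ℚ) (ι 1ℚ) 1-pos 1-pos
      λ x → NonNeg-resp (sym (-‿inverseʳ _)) nonNeg-0)
    definiteness {suc n} M M-sym = sign (M zero zero) >>= λ where
      (inj₁ a>0) → definiteness (schur M) (schur-symmetric M-sym) >>= λ where
        (negative y S<0)               → pure (negative-schur M M-sym a>0 y S<0)
        (degenerate s s>0 S≥0 w w≠0 e) → pure (degenerate-schur M M-sym a>0 s s>0 S≥0 w w≠0 e)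
        (definite s c s>0 c>0 S≥c)     → pure (definite-schur M M-sym a>0 s c s>0 c>0 S≥c)
      (inj₂ (inj₂ a<0)) → pure (negative-diagonal M M-sym a<0)
      (inj₂ (inj₁ a≈0)) → zero? (tail (M zero)) >>= λ where
        (inj₂ b≠0) → pure (negative-border M M-sym a≈0 b≠0)
        (inj₁ b≈0) → definiteness (minor M) (λ i j → M-sym (suc i) (suc j)) >>= λ D →
          pure (borderless M M-sym a≈0 b≈0 D)

  -- The shifted matrices t I - A

  diagonal : ∀ {n} → Vector Carrier n → Mat n
  diagonal d i j = if does (i Fin.≟ j) then d i else 0#

  diagonal-· : ∀ {n} (d v : Vector Carrier n) i → (diagonal d · v) i ≈ d i * v i
  diagonal-· d v zero    = trans (+-congˡ (dot-zeroˡ _ (tail v) λ _ → refl)) (+-identityʳ _)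
  diagonal-· d v (suc i) = trans (+-cong (zeroˡ _) (diagonal-· (tail d) (tail v) i)) (+-identityˡ _)

  diagonal-symmetric : ∀ {n} (d : Vector Carrier n) → Symmetric (diagonal d)
  diagonal-symmetric d i j with i Fin.≟ j | j Fin.≟ i
  ... | yes ≡.refl | yes _   = refl
  ... | yes i≡j    | no  j≢i = contradiction (≡.sym i≡j) j≢i
  ... | no  i≢j    | yes j≡i = contradiction (≡.sym j≡i) i≢j
  ... | no  _      | no  _   = refl

  dot-subˡ : ∀ {n} (v u w : Vector Carrier n) → dot (λ i → u i - w i) v ≈ dot u v - dot w v
  dot-subˡ v u w = begin
    dot (λ i → u i - w i) v
      ≈⟨ dot-cong (λ i → solve 2 (λ u w → u :- w := con 1ℚ :* u :+ con (ℚ.- 1ℚ) :* w) refl (u i) (w i)) (λ _ → refl) ⟩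
    dot (λ i → ι 1ℚ * u i + ι (ℚ.- 1ℚ) * w i) v
      ≈⟨ dot-linearˡ v (ι 1ℚ) u (ι (ℚ.- 1ℚ)) w ⟩
    ι 1ℚ * dot u v + ι (ℚ.- 1ℚ) * dot w v
      ≈⟨ solve 2 (λ u w → con 1ℚ :* u :+ con (ℚ.- 1ℚ) :* w := u :- w) refl (dot u v) (dot w v) ⟩
    dot u v - dot w v ∎

  _I-_ : ∀ {n} → Carrier → Mat n → Mat n
  (t I- A) i j = diagonal (replicate _ t) i j - A i j

  I--symmetric : ∀ {n} t {A : Mat n} → Symmetric A → Symmetric (t I- A)
  I--symmetric t A-sym i j = +-cong (diagonal-symmetric (replicate _ t) i j) (-‿cong (A-sym i j))

  I--· : ∀ {n} t (A : Mat n) v i → ((t I- A) · v) i ≈ t * v i - (A · v) i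
  I--· t A v i = trans (dot-subˡ v (diagonal (replicate _ t) i) (A i)) (+-congʳ (diagonal-· (replicate _ t) v i))

  quad-I- : ∀ {n} t (A : Mat n) v → quad (t I- A) v ≈ t * dot v v - quad A v
  quad-I- t A v = begin
    dot v ((t I- A) · v)                      ≈⟨ trans (dot-cong (λ _ → refl) (I--· t A v)) (dot-comm v _) ⟩
    dot (λ i → t * v i - (A · v) i) v         ≈⟨ dot-subˡ v (λ i → t * v i) (A · v) ⟩
    dot (λ i → t * v i) v - dot (A · v) v     ≈⟨ +-cong (trans (dot-comm _ v) (dot-scale v t v)) (-‿cong (dot-comm (A · v) v)) ⟩
    t * dot v v - quad A v                    ∎

  kernel⇒eigenvector : ∀ {n} t (A : Mat n) v → (∀ i → ((t I- A) · v) i ≈ 0#) → ∀ i → (A · v) i ≈ t * v i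
  kernel⇒eigenvector t A v Mv≈0 i = sym (x∙y⁻¹≈ε⇒x≈y (t * v i) ((A · v) i) (trans (sym (I--· t A v i)) (Mv≈0 i)))
    where open GroupProperties +-group using (x∙y⁻¹≈ε⇒x≈y)

  definite-I- : ∀ {n} s c t (A : Mat n) v → NonNeg (s * quad (t I- A) v - c * dot v v) →
                NonNeg (s * (t * dot v v - quad A v) - c * dot v v)
  definite-I- s c t A v = NonNeg-resp (+-congʳ (*-congˡ (quad-I- t A v)))

-- Rational and real numbers as ordered algebras

open import Defs

p≤q⇒0≤q-p : ∀ {p q} → p ℚ.≤ q → 0ℚ ℚ.≤ q ℚ.- p
p≤q⇒0≤q-p {p} {q} p≤q = subst (ℚ._≤ q ℚ.- p) (ℚ.+-inverseʳ p) (ℚ.+-monoˡ-≤ (ℚ.- p) p≤q)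

0≤q-p⇒p≤q : ∀ {p q} → 0ℚ ℚ.≤ q ℚ.- p → p ℚ.≤ q
0≤q-p⇒p≤q {p} {q} h = subst₂ ℚ._≤_ (ℚ.+-identityˡ p)
  (solve 2 (λ p q → (q :- p) :+ p := q) ≡.refl p q) (ℚ.+-monoˡ-≤ p h)
  where open ℚ-Solver

p<q⇒0<q-p : ∀ {p q} → p ℚ.< q → 0ℚ ℚ.< q ℚ.- p
p<q⇒0<q-p {p} {q} p<q = subst (ℚ._< q ℚ.- p) (ℚ.+-inverseʳ p) (ℚ.+-monoˡ-< (ℚ.- p) p<q)

0<q-p⇒p<q : ∀ {p q} → 0ℚ ℚ.< q ℚ.- p → p ℚ.< q
0<q-p⇒p<q {p} {q} h = subst₂ ℚ._<_ (ℚ.+-identityˡ p)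
  (solve 2 (λ p q → (q :- p) :+ p := q) ≡.refl p q) (ℚ.+-monoˡ-< p h)
  where open ℚ-Solver

0≤p*q : ∀ {p q} → 0ℚ ℚ.≤ p → 0ℚ ℚ.≤ q → 0ℚ ℚ.≤ p ℚ.* q
0≤p*q {p} {q} 0≤p 0≤q = subst (ℚ._≤ p ℚ.* q) (ℚ.*-zeroʳ p)
  (ℚ.*-monoˡ-≤-nonNeg p {{ℚ.nonNegative 0≤p}} 0≤q)

0<p*q : ∀ {p q} → 0ℚ ℚ.< p → 0ℚ ℚ.< q → 0ℚ ℚ.< p ℚ.* q
0<p*q {p} {q} 0<p 0<q = subst (ℚ._< p ℚ.* q) (ℚ.*-zeroʳ p)
  (ℚ.*-monoʳ-<-pos p {{ℚ.positive 0<p}} 0<q)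

0≤p*p : ∀ p → 0ℚ ℚ.≤ p ℚ.* p
0≤p*p p with ℚ.≤-total 0ℚ p
... | inj₁ 0≤p = 0≤p*q 0≤p 0≤p
... | inj₂ p≤0 = subst (0ℚ ℚ.≤_) (solve 1 (λ p → :- p :* :- p := p :* p) ≡.refl p) (0≤p*q 0≤-p 0≤-p)
  where
  open ℚ-Solver
  0≤-p : 0ℚ ℚ.≤ ℚ.- p
  0≤-p = ℚ.neg-antimono-≤ p≤0

ℚ-algebra : OrderedAlgebra
ℚ-algebra = record
  { commutativeRing = ℚ.+-*-commutativeRing
  ; morphism        = -raw-almostCommutative⟶ (fromCommutativeRing ℚ.+-*-commutativeRing)
  ; Pos             = 0ℚ ℚ.<_
  ; NonNeg          = 0ℚ ℚ.≤_
  ; Pos-resp        = subst (0ℚ ℚ.<_)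
  ; NonNeg-resp     = subst (0ℚ ℚ.≤_)
  ; ι-pos           = λ 0<p → 0<p
  ; pos*pos         = 0<p*q
  ; pos*nonNeg      = λ 0<p → 0≤p*q (ℚ.<⇒≤ 0<p)
  ; pos+nonNeg      = ℚ.+-mono-<-≤
  ; nonNeg+nonNeg   = ℚ.+-mono-≤
  ; pos⇒nonNeg      = ℚ.<⇒≤
  ; square-nonNeg   = 0≤p*p
  }

ℚ-sign : ∀ p → 0ℚ ℚ.< p ⊎ p ≡ 0ℚ ⊎ 0ℚ ℚ.< ℚ.- p
ℚ-sign p with ℚ.<-cmp 0ℚ p
... | tri< 0<p _ _ = inj₁ 0<p
... | tri≈ _ 0≡p _ = inj₂ (inj₁ (≡.sym 0≡p))
... | tri> _ _ p<0 = inj₂ (inj₂ (ℚ.neg-antimono-< p<0))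

0<½* : ∀ {e} → 0ℚ ℚ.< e → 0ℚ ℚ.< ½ ℚ.* e
0<½* = 0<p*q (ℚ.positive⁻¹ ½)

divide : ∀ {e b} → 0ℚ ℚ.< e → 0ℚ ℚ.< b → ∃[ d ] 0ℚ ℚ.< d × d ℚ.* b ≡ e
divide {e} {b} 0<e 0<b = e ℚ.* b⁻¹ , 0<p*q 0<e (ℚ.positive⁻¹ b⁻¹ {{ℚ.1/pos⇒pos b}}) , (begin
  e ℚ.* b⁻¹ ℚ.* b   ≡⟨ ℚ.*-assoc e b⁻¹ b ⟩
  e ℚ.* (b⁻¹ ℚ.* b) ≡⟨ cong (e ℚ.*_) (ℚ.*-inverseˡ b) ⟩
  e ℚ.* 1ℚ          ≡⟨ ℚ.*-identityʳ e ⟩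
  e                 ∎)
  where
  open ≡.≡-Reasoning
  instance
    b>0 : ℚ.Positive b
    b>0 = ℚ.positive 0<b
    b≢0 : ℚ.NonZero b
    b≢0 = ℚ.pos⇒nonZero b
  b⁻¹ = ℚ.1/ b

p≤∣p∣ : ∀ p → p ℚ.≤ ℚ.∣ p ∣
p≤∣p∣ p with ℚ.≤-total 0ℚ p
... | inj₁ 0≤p = ℚ.≤-reflexive (≡.sym (ℚ.0≤p⇒∣p∣≡p 0≤p))
... | inj₂ p≤0 = ℚ.≤-trans p≤0 (ℚ.0≤∣p∣ p)

∣p-q∣≡∣q-p∣ : ∀ p q → ℚ.∣ p ℚ.- q ∣ ≡ ℚ.∣ q ℚ.- p ∣
∣p-q∣≡∣q-p∣ p q = ≡.trans (≡.sym (ℚ.∣-p∣≡∣p∣ (p ℚ.- q)))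
  (cong ℚ.∣_∣ (solve 2 (λ p q → :- (p :- q) := q :- p) ≡.refl p q))
  where open ℚ-Solver

∣p∣<e : ∀ {p e} → p ℚ.< e → ℚ.- p ℚ.< e → ℚ.∣ p ∣ ℚ.< e
∣p∣<e {p} p<e -p<e with ℚ.∣p∣≡p∨∣p∣≡-p p
... | inj₁ eq = subst (ℚ._< _) (≡.sym eq) p<e
... | inj₂ eq = subst (ℚ._< _) (≡.sym eq) -p<e

∣p-q∣<e⇒p<q+e : ∀ p q {e} → ℚ.∣ p ℚ.- q ∣ ℚ.< e → p ℚ.< q ℚ.+ e
∣p-q∣<e⇒p<q+e p q {e} h = subst (ℚ._< q ℚ.+ e) (solve 2 (λ p q → q :+ (p :- q) := p) ≡.refl p q)
  (ℚ.+-monoʳ-< q (ℚ.≤-<-trans (p≤∣p∣ (p ℚ.- q)) h))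
  where open ℚ-Solver

∣p-q∣<e⇒q<p+e : ∀ p q {e} → ℚ.∣ p ℚ.- q ∣ ℚ.< e → q ℚ.< p ℚ.+ e
∣p-q∣<e⇒q<p+e p q h = ∣p-q∣<e⇒p<q+e q p (subst (ℚ._< _) (∣p-q∣≡∣q-p∣ p q) h)

∣p-q∣<e : ∀ {p q e} → p ℚ.< q ℚ.+ e → q ℚ.< p ℚ.+ e → ℚ.∣ p ℚ.- q ∣ ℚ.< e
∣p-q∣<e {p} {q} {e} p<q+e q<p+e = ∣p∣<e
  (0<q-p⇒p<q (subst (0ℚ ℚ.<_) (solve 3 (λ p q e → (q :+ e) :- p := e :- (p :- q)) ≡.refl p q e) (p<q⇒0<q-p p<q+e)))
  (0<q-p⇒p<q (subst (0ℚ ℚ.<_) (solve 3 (λ p q e → (p :+ e) :- q := e :- (:- (p :- q))) ≡.refl p q e) (p<q⇒0<q-p q<p+e)))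
  where open ℚ-Solver

-- Arithmetic and order of the Cauchy reals

Eventually : (ℕ → Set) → Set
Eventually P = ∃[ N ] ∀ n → N ℕ.≤ n → P n

always : ∀ {P} → (∀ n → P n) → Eventually P
always p = 0 , λ n _ → p n

ev-map : ∀ {P Q : ℕ → Set} → (∀ {n} → P n → Q n) → Eventually P → Eventually Q
ev-map f (N , p) = N , λ n N≤n → f (p n N≤n)

ev-map₂ : ∀ {P Q R : ℕ → Set} → (∀ {n} → P n → Q n → R n) →
          Eventually P → Eventually Q → Eventually R
ev-map₂ f (M , p) (N , q) = M ℕ.⊔ N , λ n h →
  f (p n (ℕ.m⊔n≤o⇒m≤o M N h)) (q n (ℕ.m⊔n≤o⇒n≤o M N h))

ev-witness : ∀ {P} → Eventually P → ∃[ n ] P n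
ev-witness (N , p) = N , p N ℕ.≤-refl

bounded : ∀ x → ∃[ B ] 0ℚ ℚ.< B × Eventually (λ n → ℚ.∣ seq x n ∣ ℚ.≤ B)
bounded x with N , close ← cauchy x 1ℚ (ℚ.positive⁻¹ 1ℚ) =
  ℚ.∣ a ∣ ℚ.+ 1ℚ , ℚ.+-mono-≤-< (ℚ.0≤∣p∣ a) (ℚ.positive⁻¹ 1ℚ) , N , λ n N≤n →
    subst (λ p → ℚ.∣ p ∣ ℚ.≤ ℚ.∣ a ∣ ℚ.+ 1ℚ)
      (solve 2 (λ a x → a :+ (x :- a) := x) ≡.refl a (seq x n))
      (ℚ.≤-trans (ℚ.∣p+q∣≤∣p∣+∣q∣ a (seq x n ℚ.- a))
        (ℚ.+-monoʳ-≤ ℚ.∣ a ∣ (ℚ.<⇒≤ (close n N N≤n ℕ.≤-refl))))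
  where
  open ℚ-Solver
  a = seq x N

pointwise : ∀ x y → (∀ k → seq x k ≡ seq y k) → x ≈ y
pointwise x y x≡y e 0<e = always λ n →
  subst (ℚ._< e) (cong ℚ.∣_∣ (≡.sym (≡.trans (cong (ℚ._- seq y n) (x≡y n)) (ℚ.+-inverseʳ (seq y n))))) 0<e

halves : ∀ e → ½ ℚ.* e ℚ.+ ½ ℚ.* e ≡ e
halves = solve 1 (λ e → con ½ :* e :+ con ½ :* e := e) ≡.refl
  where open ℚ-Solver

≈-sym : ∀ {x y} → x ≈ y → y ≈ x
≈-sym {x} {y} x≈y e 0<e = ev-map (λ {n} → subst (ℚ._< e) (∣p-q∣≡∣q-p∣ (seq x n) (seq y n))) (x≈y e 0<e)

∣p+q∣<e : ∀ p q {e} → ℚ.∣ p ∣ ℚ.< ½ ℚ.* e → ℚ.∣ q ∣ ℚ.< ½ ℚ.* e → ℚ.∣ p ℚ.+ q ∣ ℚ.< e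
∣p+q∣<e p q {e} hp hq = ℚ.≤-<-trans (ℚ.∣p+q∣≤∣p∣+∣q∣ p q)
  (subst (_ ℚ.<_) (halves e) (ℚ.+-mono-< hp hq))

≈-trans : ∀ {x y z} → x ≈ y → y ≈ z → x ≈ z
≈-trans {x} {y} {z} x≈y y≈z e 0<e = ev-map₂
  (λ {n} p q → subst (λ d → ℚ.∣ d ∣ ℚ.< e)
    (solve 3 (λ x y z → (x :- y) :+ (y :- z) := x :- z) ≡.refl (seq x n) (seq y n) (seq z n))
    (∣p+q∣<e (seq x n ℚ.- seq y n) (seq y n ℚ.- seq z n) p q))
  (x≈y _ (0<½* 0<e)) (y≈z _ (0<½* 0<e))
  where open ℚ-Solver

+-cong : ∀ {x x′ y y′} → x ≈ x′ → y ≈ y′ → x + y ≈ x′ + y′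
+-cong {x} {x′} {y} {y′} x≈x′ y≈y′ e 0<e = ev-map₂
  (λ {n} p q → subst (λ d → ℚ.∣ d ∣ ℚ.< e)
    (solve 4 (λ x x′ y y′ → (x :- x′) :+ (y :- y′) := (x :+ y) :- (x′ :+ y′)) ≡.refl
      (seq x n) (seq x′ n) (seq y n) (seq y′ n))
    (∣p+q∣<e (seq x n ℚ.- seq x′ n) (seq y n ℚ.- seq y′ n) p q))
  (x≈x′ _ (0<½* 0<e)) (y≈y′ _ (0<½* 0<e))
  where open ℚ-Solver

*-congʳ : ∀ {z x y} → x ≈ y → x * z ≈ y * z
*-congʳ {z} {x} {y} x≈y e 0<e =
  let (B , 0<B , z≤B) = bounded z; (d , 0<d , dB≡e) = divide 0<e 0<B in
  ev-map₂ (λ {n} p q → begin-strict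
    ℚ.∣ seq x n ℚ.* seq z n ℚ.- seq y n ℚ.* seq z n ∣
      ≡⟨ cong ℚ.∣_∣ (solve 3 (λ x y z → x :* z :- y :* z := (x :- y) :* z) ≡.refl (seq x n) (seq y n) (seq z n)) ⟩
    ℚ.∣ (seq x n ℚ.- seq y n) ℚ.* seq z n ∣
      ≡⟨ ℚ.∣p*q∣≡∣p∣*∣q∣ (seq x n ℚ.- seq y n) (seq z n) ⟩
    ℚ.∣ seq x n ℚ.- seq y n ∣ ℚ.* ℚ.∣ seq z n ∣
      ≤⟨ ℚ.*-monoˡ-≤-nonNeg ℚ.∣ seq x n ℚ.- seq y n ∣ {{ℚ.∣-∣-nonNeg (seq x n ℚ.- seq y n)}} q ⟩
    ℚ.∣ seq x n ℚ.- seq y n ∣ ℚ.* B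
      <⟨ ℚ.*-monoˡ-<-pos B {{ℚ.positive 0<B}} p ⟩
    d ℚ.* B ≡⟨ dB≡e ⟩
    e ∎) (x≈y d 0<d) z≤B
  where
  open ℚ-Solver
  open ℚ.≤-Reasoning

*-comm : ∀ x y → x * y ≈ y * x
*-comm x y = pointwise (x * y) (y * x) λ k → ℚ.*-comm (seq x k) (seq y k)

*-cong : ∀ {x x′ y y′} → x ≈ x′ → y ≈ y′ → x * y ≈ x′ * y′
*-cong {x} {x′} {y} {y′} x≈x′ y≈y′ = ≈-trans {x * y} {x′ * y} {x′ * y′} (*-congʳ {y} {x} {x′} x≈x′)
  (≈-trans {x′ * y} {y * x′} {x′ * y′} (*-comm x′ y)
    (≈-trans {y * x′} {y′ * x′} {x′ * y′} (*-congʳ {x′} {y} {y′} y≈y′) (*-comm y′ x′)))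

-- As a product with -1, negation inherits its Cauchy proof and its congruence from multiplication.
-_ : ℝ → ℝ
- x = fromℚ (ℚ.- 1ℚ) * x

ℝ-ring : CommutativeRing 0ℓ 0ℓ
ℝ-ring = record
  { Carrier = ℝ ; _≈_ = _≈_ ; _+_ = _+_ ; _*_ = _*_ ; -_ = -_ ; 0# = 0ℝ ; 1# = 1ℝ
  ; isCommutativeRing = record
    { isRing = record
      { +-isAbelianGroup = record
        { isGroup = record
          { isMonoid = record
            { isSemigroup = record
              { isMagma = record
                { isEquivalence = record
                  { refl = λ {x} → pointwise x x λ _ → ≡.refl
                  ; sym = λ {x} {y} → ≈-sym {x} {y} ; trans = λ {x} {y} {z} → ≈-trans {x} {y} {z} }
                ; ∙-cong = λ {x} {x′} {y} {y′} → +-cong {x} {x′} {y} {y′} }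
              ; assoc = λ x y z → pointwise (x + y + z) (x + (y + z)) λ k → ℚ.+-assoc (seq x k) (seq y k) (seq z k) }
            ; identity = (λ x → pointwise (0ℝ + x) x λ k → ℚ.+-identityˡ (seq x k))
                       , (λ x → pointwise (x + 0ℝ) x λ k → ℚ.+-identityʳ (seq x k)) }
          ; inverse = (λ x → pointwise (- x + x) 0ℝ λ k → solve 1 (λ x → con (ℚ.- 1ℚ) :* x :+ x := con 0ℚ) ≡.refl (seq x k))
                    , (λ x → pointwise (x + - x) 0ℝ λ k → solve 1 (λ x → x :+ con (ℚ.- 1ℚ) :* x := con 0ℚ) ≡.refl (seq x k))
          ; ⁻¹-cong = λ {x} {y} x≈y → *-cong {fromℚ (ℚ.- 1ℚ)} {fromℚ (ℚ.- 1ℚ)} {x} {y} (pointwise (fromℚ (ℚ.- 1ℚ)) (fromℚ (ℚ.- 1ℚ)) λ _ → ≡.refl) x≈y }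
        ; comm = λ x y → pointwise (x + y) (y + x) λ k → ℚ.+-comm (seq x k) (seq y k) }
      ; *-cong = λ {x} {x′} {y} {y′} → *-cong {x} {x′} {y} {y′}
      ; *-assoc = λ x y z → pointwise (x * y * z) (x * (y * z)) λ k → ℚ.*-assoc (seq x k) (seq y k) (seq z k)
      ; *-identity = (λ x → pointwise (1ℝ * x) x λ k → ℚ.*-identityˡ (seq x k))
                   , (λ x → pointwise (x * 1ℝ) x λ k → ℚ.*-identityʳ (seq x k))
      ; distrib = (λ x y z → pointwise (x * (y + z)) (x * y + x * z) λ k → ℚ.*-distribˡ-+ (seq x k) (seq y k) (seq z k))
                , (λ x y z → pointwise ((y + z) * x) (y * x + z * x) λ k → ℚ.*-distribʳ-+ (seq x k) (seq y k) (seq z k)) }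
    ; *-comm = *-comm }
  }
  where open ℚ-Solver

-- The rational lower bound makes this invariant under `_≈_`; termwise positivity would also hold of
-- 1/n, which represents zero.
Positive : ℝ → Set
Positive x = ∃[ c ] 0ℚ ℚ.< c × Eventually (λ n → c ℚ.≤ seq x n)

≤-respʳ-≈ : ∀ {x y z} → x ≈ y → z ≤ x → z ≤ y
≤-respʳ-≈ {x} {y} {z} x≈y z≤x e 0<e = ev-map₂
  (λ {n} p q → ℚ.<-trans p (subst (seq x n ℚ.+ ½ ℚ.* e ℚ.<_)
    (≡.trans (ℚ.+-assoc (seq y n) (½ ℚ.* e) (½ ℚ.* e)) (cong (seq y n ℚ.+_) (halves e)))
    (ℚ.+-monoˡ-< (½ ℚ.* e) (∣p-q∣<e⇒p<q+e (seq x n) (seq y n) q))))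
  (z≤x _ (0<½* 0<e)) (x≈y _ (0<½* 0<e))

Positive-resp : ∀ {x y} → x ≈ y → Positive x → Positive y
Positive-resp {x} {y} x≈y (c , 0<c , c≤x) = ½ ℚ.* c , 0<½* 0<c , ev-map₂
  (λ {n} p q → ℚ.<⇒≤ (0<q-p⇒p<q (subst (0ℚ ℚ.<_)
    (solve 3 (λ c x y → ((y :+ con ½ :* c) :- x) :+ (x :- c) := y :- con ½ :* c) ≡.refl c (seq x n) (seq y n))
    (ℚ.+-mono-<-≤ (p<q⇒0<q-p (∣p-q∣<e⇒p<q+e (seq x n) (seq y n) q)) (p≤q⇒0≤q-p p)))))
  c≤x (x≈y _ (0<½* 0<c))
  where open ℚ-Solver

-- The terms of `y` may lie below zero by any small d. Multiplication by `x` enlarges this error at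
-- most by a bound B of `x`, whence d = e / B.
ℝ-pos*nonNeg : ∀ {x y} → Positive x → 0ℝ ≤ y → 0ℝ ≤ x * y
ℝ-pos*nonNeg {x} {y} (c , 0<c , c≤x) 0≤y e 0<e =
  let (B , 0<B , x≤B) = bounded x; (d , 0<d , dB≡e) = divide 0<e 0<B in
  ev-map₂ (λ {n} (c≤x , x≤B) 0<y+d → begin-strict
    0ℚ                                    <⟨ 0<p*q (ℚ.<-≤-trans 0<c c≤x) 0<y+d ⟩
    seq x n ℚ.* (seq y n ℚ.+ d)           ≡⟨ ℚ.*-distribˡ-+ (seq x n) (seq y n) d ⟩
    seq x n ℚ.* seq y n ℚ.+ seq x n ℚ.* d ≤⟨ ℚ.+-monoʳ-≤ (seq x n ℚ.* seq y n)
      (ℚ.*-monoʳ-≤-nonNeg d {{ℚ.nonNegative (ℚ.<⇒≤ 0<d)}} (ℚ.≤-trans (p≤∣p∣ (seq x n)) x≤B)) ⟩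
    seq x n ℚ.* seq y n ℚ.+ B ℚ.* d       ≡⟨ cong (seq x n ℚ.* seq y n ℚ.+_) (≡.trans (ℚ.*-comm B d) dB≡e) ⟩
    seq x n ℚ.* seq y n ℚ.+ e             ∎)
    (ev-map₂ _,_ c≤x x≤B) (0≤y d 0<d)
  where open ℚ.≤-Reasoning

ℝ-algebra : OrderedAlgebra
ℝ-algebra = record
  { commutativeRing = ℝ-ring
  ; morphism        = record
    { ⟦_⟧    = fromℚ
    ; +-homo = λ p q → pointwise (fromℚ (p ℚ.+ q)) (fromℚ p + fromℚ q) λ _ → ≡.refl
    ; *-homo = λ p q → pointwise (fromℚ (p ℚ.* q)) (fromℚ p * fromℚ q) λ _ → ≡.refl
    ; -‿homo = λ p → pointwise (fromℚ (ℚ.- p)) (- fromℚ p) λ _ → solve 1 (λ p → :- p := con (ℚ.- 1ℚ) :* p) ≡.refl p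
    ; 0-homo = pointwise (fromℚ 0ℚ) 0ℝ λ _ → ≡.refl
    ; 1-homo = pointwise (fromℚ 1ℚ) 1ℝ λ _ → ≡.refl
    }
  ; Pos           = Positive
  ; NonNeg        = 0ℝ ≤_
  ; Pos-resp      = λ {x} {y} → Positive-resp {x} {y}
  ; NonNeg-resp   = λ {x} {y} → ≤-respʳ-≈ {x} {y} {0ℝ}
  ; ι-pos         = λ {p} 0<p → p , 0<p , always λ _ → ℚ.≤-refl
  ; pos*pos       = λ { {x} {y} (c , 0<c , c≤x) (d , 0<d , d≤y) → c ℚ.* d , 0<p*q 0<c 0<d ,
      ev-map₂ (λ {n} c≤x d≤y → ℚ.≤-trans
        (ℚ.*-monoʳ-≤-nonNeg d {{ℚ.nonNegative (ℚ.<⇒≤ 0<d)}} c≤x)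
        (ℚ.*-monoˡ-≤-nonNeg (seq x n) {{ℚ.nonNegative (ℚ.≤-trans (ℚ.<⇒≤ 0<c) c≤x)}} d≤y)) c≤x d≤y }
  ; pos*nonNeg    = λ {x} {y} → ℝ-pos*nonNeg {x} {y}
  ; pos+nonNeg    = λ { {x} {y} (c , 0<c , c≤x) 0≤y → ½ ℚ.* c , 0<½* 0<c , ev-map₂
      (λ {n} c≤x 0<y → ℚ.<⇒≤ (0<q-p⇒p<q (subst (0ℚ ℚ.<_)
        (solve 3 (λ c x y → (x :- c) :+ (y :+ con ½ :* c) := (x :+ y) :- con ½ :* c) ≡.refl c (seq x n) (seq y n))
        (ℚ.+-mono-≤-< (p≤q⇒0≤q-p c≤x) 0<y)))) c≤x (0≤y _ (0<½* 0<c)) }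
  ; nonNeg+nonNeg = λ {x} {y} 0≤x 0≤y e 0<e → ev-map₂
      (λ {n} 0<x 0<y → subst (0ℚ ℚ.<_)
        (solve 3 (λ x y e → (x :+ con ½ :* e) :+ (y :+ con ½ :* e) := (x :+ y) :+ e) ≡.refl (seq x n) (seq y n) e)
        (ℚ.+-mono-< 0<x 0<y)) (0≤x _ (0<½* 0<e)) (0≤y _ (0<½* 0<e))
  ; pos⇒nonNeg    = λ { {x} (c , 0<c , c≤x) e 0<e → ev-map
      (λ c≤x → ℚ.+-mono-< (ℚ.<-≤-trans 0<c c≤x) 0<e) c≤x }
  ; square-nonNeg = λ x e 0<e → always λ n → ℚ.+-mono-≤-< (0≤p*p (seq x n)) 0<e
  }
  where open ℚ-Solver

-- Suppose no sign can be had. If the term at a stage with Cauchy modulus e/4 were at least e/2, all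
-- later terms would exceed e/4 and `x` would be positive; likewise for `- x`. So that term is below
-- e/2 in absolute value and all later ones are below e, which is `x ≈ 0ℝ`.
ℝ-sign : ∀ x → DoubleNegation (Positive x ⊎ x ≈ 0ℝ ⊎ Positive (- x))
ℝ-sign x ¬sign = ¬sign (inj₂ (inj₁ x≈0))
  where
  open ℚ-Solver
  x≈0 : x ≈ 0ℝ
  x≈0 e 0<e with N , close ← cauchy x (½ ℚ.* (½ ℚ.* e)) (0<½* (0<½* 0<e))
    with ½ ℚ.* e ℚ.≤? seq x N | ½ ℚ.* e ℚ.≤? ℚ.- seq x N
  ... | yes h | _ = contradiction (inj₁ (½ ℚ.* (½ ℚ.* e) , 0<½* (0<½* 0<e) , N , λ n N≤n →
    ℚ.<⇒≤ (0<q-p⇒p<q (subst (0ℚ ℚ.<_)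
      (solve 3 (λ a x e → (a :- con ½ :* e) :+ ((x :+ con ½ :* (con ½ :* e)) :- a) := x :- con ½ :* (con ½ :* e))
        ≡.refl (seq x N) (seq x n) e)
      (ℚ.+-mono-≤-< (p≤q⇒0≤q-p h) (p<q⇒0<q-p (∣p-q∣<e⇒q<p+e (seq x n) (seq x N) (close n N N≤n ℕ.≤-refl)))))))) ¬sign
  ... | no _ | yes h = contradiction (inj₂ (inj₂ (½ ℚ.* (½ ℚ.* e) , 0<½* (0<½* 0<e) , N , λ n N≤n →
    ℚ.<⇒≤ (0<q-p⇒p<q (subst (0ℚ ℚ.<_)
      (solve 3 (λ a x e → (:- a :- con ½ :* e) :+ ((a :+ con ½ :* (con ½ :* e)) :- x) := con (ℚ.- 1ℚ) :* x :- con ½ :* (con ½ :* e))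
        ≡.refl (seq x N) (seq x n) e)
      (ℚ.+-mono-≤-< (p≤q⇒0≤q-p h) (p<q⇒0<q-p (∣p-q∣<e⇒p<q+e (seq x n) (seq x N) (close n N N≤n ℕ.≤-refl))))))))) ¬sign
  ... | no h | no h′ = N , λ n N≤n →
    subst (λ d → ℚ.∣ d ∣ ℚ.< e) (solve 2 (λ a x → (x :- a) :+ a := x :- con 0ℚ) ≡.refl (seq x N) (seq x n))
      (∣p+q∣<e (seq x n ℚ.- seq x N) (seq x N)
        (ℚ.<-trans (close n N N≤n ℕ.≤-refl) (quarter e 0<e))
        (∣p∣<e (ℚ.≰⇒> h) (ℚ.≰⇒> h′)))
    where
    quarter : ∀ e → 0ℚ ℚ.< e → ½ ℚ.* (½ ℚ.* e) ℚ.< ½ ℚ.* e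
    quarter e 0<e = 0<q-p⇒p<q (subst (0ℚ ℚ.<_)
      (solve 1 (λ e → con ½ :* (con ½ :* e) := con ½ :* e :- con ½ :* (con ½ :* e)) ≡.refl e) (0<½* (0<½* 0<e)))

-- The largest eigenvalue

⌜_⌝ : ℕ → ℚ
⌜ k ⌝ = + k ℚ./ 1

toℚᵘ-⌜⌝ : ∀ k → ℚ.toℚᵘ ⌜ k ⌝ ℚᵘ.≃ mkℚᵘ (+ k) 0
toℚᵘ-⌜⌝ k = ℚ.toℚᵘ-fromℚᵘ (mkℚᵘ (+ k) 0)

⌜⌝-+ : ∀ m n → ⌜ m ℕ.+ n ⌝ ≡ ⌜ m ⌝ ℚ.+ ⌜ n ⌝
⌜⌝-+ m n = ℚ.toℚᵘ-injective (begin
  ℚ.toℚᵘ ⌜ m ℕ.+ n ⌝              ≈⟨ toℚᵘ-⌜⌝ (m ℕ.+ n) ⟩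
  mkℚᵘ (+ (m ℕ.+ n)) 0            ≈⟨ ℚᵘ.*≡* (cong (ℤ._* + 1) (≡.trans (ℤ.pos-+ m n)
    (≡.sym (cong₂ ℤ._+_ (ℤ.*-identityʳ (+ m)) (ℤ.*-identityʳ (+ n)))))) ⟩
  mkℚᵘ (+ m) 0 ℚᵘ.+ mkℚᵘ (+ n) 0  ≈⟨ ℚᵘ.+-cong (toℚᵘ-⌜⌝ m) (toℚᵘ-⌜⌝ n) ⟨
  ℚ.toℚᵘ ⌜ m ⌝ ℚᵘ.+ ℚ.toℚᵘ ⌜ n ⌝  ≈⟨ ℚ.toℚᵘ-homo-+ ⌜ m ⌝ ⌜ n ⌝ ⟨
  ℚ.toℚᵘ (⌜ m ⌝ ℚ.+ ⌜ n ⌝)        ∎)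
  where open ℚᵘ.≃-Reasoning

⌜⌝-* : ∀ m n → ⌜ m ℕ.* n ⌝ ≡ ⌜ m ⌝ ℚ.* ⌜ n ⌝
⌜⌝-* m n = ℚ.toℚᵘ-injective (begin
  ℚ.toℚᵘ ⌜ m ℕ.* n ⌝              ≈⟨ toℚᵘ-⌜⌝ (m ℕ.* n) ⟩
  mkℚᵘ (+ (m ℕ.* n)) 0            ≈⟨ ℚᵘ.*≡* (cong (ℤ._* + 1) (ℤ.pos-* m n)) ⟩
  mkℚᵘ (+ m) 0 ℚᵘ.* mkℚᵘ (+ n) 0  ≈⟨ ℚᵘ.*-cong (toℚᵘ-⌜⌝ m) (toℚᵘ-⌜⌝ n) ⟨
  ℚ.toℚᵘ ⌜ m ⌝ ℚᵘ.* ℚ.toℚᵘ ⌜ n ⌝  ≈⟨ ℚ.toℚᵘ-homo-* ⌜ m ⌝ ⌜ n ⌝ ⟨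
  ℚ.toℚᵘ (⌜ m ⌝ ℚ.* ⌜ n ⌝)        ∎)
  where open ℚᵘ.≃-Reasoning

⌜⌝-mono : ∀ {m n} → m ℕ.≤ n → ⌜ m ⌝ ℚ.≤ ⌜ n ⌝
⌜⌝-mono {m} {n} m≤n = ℚ.toℚᵘ-cancel-≤
  (ℚᵘ.≤-respˡ-≃ (ℚᵘ.≃-sym (toℚᵘ-⌜⌝ m)) (ℚᵘ.≤-respʳ-≃ (ℚᵘ.≃-sym (toℚᵘ-⌜⌝ n))
    (ℚᵘ.*≤* (ℤ.*-monoʳ-≤-nonNeg (+ 1) (ℤ.+≤+ m≤n)))))

archimedean : ∀ p → ∃[ N ] p ℚ.< ⌜ N ⌝
archimedean p@record{} = suc ℤ.∣ ℚ.↥ p ∣ , ℚ.toℚᵘ-cancel-<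
  (ℚᵘ.<-respʳ-≃ (ℚᵘ.≃-sym (toℚᵘ-⌜⌝ (suc ℤ.∣ ℚ.↥ p ∣))) (ℚᵘ.*<* (numerator< p)))
  where
  numerator< : ∀ p → ℚ.↥ p ℤ.* + 1 ℤ.< + suc ℤ.∣ ℚ.↥ p ∣ ℤ.* ℚ.↧ p
  numerator< (mkℚ (+ a)    d _) = subst (ℤ._< + (suc a ℕ.* suc d)) (≡.sym (ℤ.*-identityʳ (+ a)))
    (+<+ (ℕ.m≤m*n (suc a) (suc d)))
  numerator< (mkℚ -[1+ a ] d _) = ℤ.-<+

0≤s*p⇒0≤p : ∀ s p → 0ℚ ℚ.< s → 0ℚ ℚ.≤ s ℚ.* p → 0ℚ ℚ.≤ p
0≤s*p⇒0≤p s p 0<s 0≤sp = ℚ.*-cancelˡ-≤-pos s {{ℚ.positive 0<s}}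
  (subst (ℚ._≤ s ℚ.* p) (≡.sym (ℚ.*-zeroʳ s)) 0≤sp)

module ℚLin = LinearAlgebra ℚ-algebra
module ℝLin = LinearAlgebra ℝ-algebra

-- Bisection for the supremum of the Rayleigh quotients

width : ℚ → ℕ → ℚ
width w zero    = w
width w (suc k) = ½ ℚ.* width w k

0≤width : ∀ {w} → 0ℚ ℚ.≤ w → ∀ k → 0ℚ ℚ.≤ width w k
0≤width 0≤w zero    = 0≤w
0≤width 0≤w (suc k) = 0≤p*q (ℚ.nonNegative⁻¹ ½) (0≤width 0≤w k)

½*-mono : ∀ {p q} → p ℚ.≤ q → ½ ℚ.* p ℚ.≤ ½ ℚ.* q
½*-mono = ℚ.*-monoˡ-≤-nonNeg ½

-- A linear rate of decay suffices for the Archimedean argument. Both bounds go through the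
-- induction together, since (k + 1) (v / 2) = v / 2 + k v / 2.
width-bound : ∀ {w} → 0ℚ ℚ.≤ w → ∀ k → width w k ℚ.≤ w × ⌜ k ⌝ ℚ.* width w k ℚ.≤ w
width-bound {w} 0≤w zero    = ℚ.≤-refl , subst (ℚ._≤ w) (≡.sym (ℚ.*-zeroˡ w)) 0≤w
width-bound {w} 0≤w (suc k) with v≤w , kv≤w ← width-bound 0≤w k =
  ℚ.≤-trans (½*-mono v≤w) (subst₂ ℚ._≤_ (ℚ.+-identityʳ (½ ℚ.* w)) (halves w)
    (ℚ.+-monoʳ-≤ (½ ℚ.* w) (0≤p*q (ℚ.nonNegative⁻¹ ½) 0≤w))) ,
  (begin
    ⌜ suc k ⌝ ℚ.* (½ ℚ.* v)             ≡⟨ cong (ℚ._* (½ ℚ.* v)) (⌜⌝-+ 1 k) ⟩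
    (1ℚ ℚ.+ ⌜ k ⌝) ℚ.* (½ ℚ.* v)        ≡⟨ solve 2 (λ k v → (con 1ℚ :+ k) :* (con ½ :* v) := con ½ :* v :+ con ½ :* (k :* v)) ≡.refl ⌜ k ⌝ v ⟩
    ½ ℚ.* v ℚ.+ ½ ℚ.* (⌜ k ⌝ ℚ.* v)     ≤⟨ ℚ.+-mono-≤ (½*-mono v≤w) (½*-mono kv≤w) ⟩
    ½ ℚ.* w ℚ.+ ½ ℚ.* w                 ≡⟨ halves w ⟩
    w                                   ∎)
  where
  open ℚ.≤-Reasoning
  open ℚ-Solver
  v = width w k

width→0 : ∀ {w} → 0ℚ ℚ.≤ w → ∀ {e} → 0ℚ ℚ.< e → Eventually (λ k → width w k ℚ.< e)
width→0 {w} 0≤w {e} 0<e =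
  let d , _ , de≡w = divide′; N , d<N = archimedean d in
  N , λ k N≤k → ℚ.≰⇒> λ e≤v → ℚ.<-irrefl ≡.refl (begin-strict
    w                   ≡⟨ de≡w ⟨
    d ℚ.* e             <⟨ ℚ.*-monoˡ-<-pos e {{ℚ.positive 0<e}} d<N ⟩
    ⌜ N ⌝ ℚ.* e         ≤⟨ ℚ.*-monoʳ-≤-nonNeg e {{ℚ.nonNegative (ℚ.<⇒≤ 0<e)}} (⌜⌝-mono N≤k) ⟩
    ⌜ k ⌝ ℚ.* e         ≤⟨ ℚ.*-monoˡ-≤-nonNeg ⌜ k ⌝ {{ℚ.nonNegative (⌜⌝-mono {0} {k} ℕ.z≤n)}} e≤v ⟩
    ⌜ k ⌝ ℚ.* width w k ≤⟨ proj₂ (width-bound 0≤w k) ⟩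
    w                   ∎)
  where
  open ℚ.≤-Reasoning
  divide′ : ∃[ d ] 0ℚ ℚ.≤ d × d ℚ.* e ≡ w
  divide′ with r , 0<r , re≡1 ← divide (ℚ.positive⁻¹ 1ℚ) 0<e =
    w ℚ.* r , 0≤p*q 0≤w (ℚ.<⇒≤ 0<r) ,
    ≡.trans (ℚ.*-assoc w r e) (≡.trans (cong (w ℚ.*_) re≡1) (ℚ.*-identityʳ w))

-- Real addition and multiplication act termwise, so the k-th term of a real form at `x` is the
-- rational form at this vector. All estimates at the threshold are made there.
stage : ∀ {n} → Vector ℝ n → ℕ → Vector ℚ n
stage x k i = seq (x i) k

seq-sum : ∀ {n} (x : Vector ℝ n) k → seq (ℝLin.sum x) k ≡ ℚLin.sum (stage x k)
seq-sum {zero}  x k = ≡.refl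
seq-sum {suc n} x k = cong (seq (x zero) k ℚ.+_) (seq-sum (x ∘ suc) k)

seq-dot : ∀ {n} (u v : Vector ℝ n) k → seq (ℝLin.dot u v) k ≡ ℚLin.dot (stage u k) (stage v k)
seq-dot u v = seq-sum (λ i → u i * v i)

module _ {n} (A : ℚLin.Mat n) (A-sym : ℚLin.Symmetric A) where

  Dominates Exceeded : ℚ → Set
  Dominates t = ∀ x → ℚLin.quad A x ℚ.≤ t ℚ.* ℚLin.dot x x
  Exceeded t = ∃[ x ] t ℚ.* ℚLin.dot x x ℚ.< ℚLin.quad A x

  exceeded⊎dominates : ∀ t → Exceeded t ⊎ Dominates t
  exceeded⊎dominates t
    with ℚLin.Elimination.definiteness Identity.monad ℚ-sign (t ℚLin.I- A) (ℚLin.I--symmetric t A-sym)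
  ... | ℚLin.negative x p = inj₁ (x , 0<q-p⇒p<q (subst (0ℚ ℚ.<_)
      (≡.trans (cong ℚ.-_ (ℚLin.quad-I- t A x))
        (solve 2 (λ d q → :- (d :- q) := q :- d) ≡.refl (t ℚ.* ℚLin.dot x x) (ℚLin.quad A x))) p))
    where open ℚ-Solver
  ... | ℚLin.degenerate s 0<s M≥0 _ _ _ = inj₂ λ x → 0≤q-p⇒p≤q (subst (0ℚ ℚ.≤_) (ℚLin.quad-I- t A x)
      (0≤s*p⇒0≤p s (ℚLin.quad (t ℚLin.I- A) x) 0<s (M≥0 x)))
  ... | ℚLin.definite s c 0<s 0<c M≥c = inj₂ λ x → 0≤q-p⇒p≤q (subst (0ℚ ℚ.≤_) (ℚLin.quad-I- t A x)
      (0≤s*p⇒0≤p s (ℚLin.quad (t ℚLin.I- A) x) 0<s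
        (ℚ.≤-trans (0≤p*q (ℚ.<⇒≤ 0<c) (ℚLin.dot-nonNeg x)) (0≤q-p⇒p≤q {c ℚ.* ℚLin.dot x x} {s ℚ.* ℚLin.quad (t ℚLin.I- A) x} (M≥c x)))))

  exceeded<dominates : ∀ {s t} → Exceeded s → Dominates t → s ℚ.< t
  exceeded<dominates {s} {t} (x , s<A) A≤t = ℚ.*-cancelʳ-<-nonNeg (ℚLin.dot x x) {{ℚ.nonNegative (ℚLin.dot-nonNeg x)}} {s} {t}
    (ℚ.<-≤-trans s<A (A≤t x))

  Bracket : ℚ → Set
  Bracket w = ∃[ t ] Exceeded t × Dominates (t ℚ.+ w)

  bisect : ∀ {w} → Bracket w → Bracket (½ ℚ.* w)
  bisect {w} (t , exceeded , dominates) with exceeded⊎dominates (t ℚ.+ ½ ℚ.* w)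
  ... | inj₂ dominates′ = t , exceeded , dominates′
  ... | inj₁ exceeded′  = t ℚ.+ ½ ℚ.* w , exceeded′ ,
    subst Dominates (≡.sym (≡.trans (ℚ.+-assoc t _ _) (cong (t ℚ.+_) (halves w)))) dominates

  bisections : ∀ {w} → Bracket w → ∀ k → Bracket (width w k)
  bisections B zero    = B
  bisections B (suc k) = bisect (bisections B k)

  module Threshold {w} (0≤w : 0ℚ ℚ.≤ w) (B : Bracket w) where

    lower : ℕ → ℚ
    lower k = proj₁ (bisections B k)

    lower-exceeded : ∀ k → Exceeded (lower k)
    lower-exceeded k = proj₁ (proj₂ (bisections B k))

    upper-dominates : ∀ k → Dominates (lower k ℚ.+ width w k)
    upper-dominates k = proj₂ (proj₂ (bisections B k))

    -- Comparing arbitrary stages, not only equal ones, places any two lower endpoints within the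
    -- width of each other's brackets. This gives the Cauchy property directly.
    lower<upper : ∀ j k → lower j ℚ.< lower k ℚ.+ width w k
    lower<upper j k = exceeded<dominates (lower-exceeded j) (upper-dominates k)

    lower-cauchy : IsCauchy lower
    lower-cauchy e 0<e = let (N , small) = width→0 0≤w 0<e in N , λ i j N≤i N≤j →
      ∣p-q∣<e {lower i} {lower j}
        (ℚ.<-trans (lower<upper i j) (ℚ.+-monoʳ-< (lower j) (small j N≤j)))
        (ℚ.<-trans (lower<upper j i) (ℚ.+-monoʳ-< (lower i) (small i N≤i)))

    threshold : ℝ
    threshold = mkℝ lower lower-cauchy

    module _ (L : ℝLin.Mat n) (L≡A : ∀ i j k → seq (L i j) k ≡ A i j) where

      seq-quad : ∀ x k → seq (ℝLin.quad L x) k ≡ ℚLin.quad A (stage x k)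
      seq-quad x k = ≡.trans (seq-dot x (L ℝLin.· x) k) (ℚLin.dot-cong {u = stage x k} (λ _ → ≡.refl) λ i →
        ≡.trans (seq-dot (L i) x k) (ℚLin.dot-cong {v = stage x k} (λ j → L≡A i j k) (λ _ → ≡.refl)))

      gap : Vector ℝ n → ℝ
      gap x = threshold * ℝLin.dot x x + - ℝLin.quad L x

      seq-gap : ∀ x k → seq (gap x) k ≡
        lower k ℚ.* ℚLin.dot (stage x k) (stage x k) ℚ.+ (ℚ.- 1ℚ) ℚ.* ℚLin.quad A (stage x k)
      seq-gap x k = cong₂ (λ d q → lower k ℚ.* d ℚ.+ (ℚ.- 1ℚ) ℚ.* q) (seq-dot x x k) (seq-quad x k)

      -- At stage k the upper endpoint dominates, so the gap is at least -(width) |x|². This tends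
      -- to zero because |x|² is bounded, which rules out a fixed negative bound -c.
      ¬gap<0 : ∀ x → ¬ Positive (- gap x)
      ¬gap<0 x (c , 0<c , c≤) =
        let (D , 0<D , x²≤D) = bounded (ℝLin.dot x x)
            (e , 0<e , eD≡c) = divide 0<c 0<D
            (k , (c≤k , x²≤Dk) , w<e) = ev-witness (ev-map₂ _,_ (ev-map₂ _,_ c≤ x²≤D) (width→0 0≤w 0<e))
            d = ℚLin.dot (stage x k) (stage x k)
            q = ℚLin.quad A (stage x k)
        in ℚ.<-irrefl ≡.refl (begin-strict
          c                               ≤⟨ c≤k ⟩
          (ℚ.- 1ℚ) ℚ.* seq (gap x) k      ≡⟨ cong ((ℚ.- 1ℚ) ℚ.*_) (seq-gap x k) ⟩
          (ℚ.- 1ℚ) ℚ.* (lower k ℚ.* d ℚ.+ (ℚ.- 1ℚ) ℚ.* q)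
            ≡⟨ solve 3 (λ l d q → con (ℚ.- 1ℚ) :* (l :* d :+ con (ℚ.- 1ℚ) :* q) := q :- l :* d) ≡.refl (lower k) d q ⟩
          q ℚ.- lower k ℚ.* d             ≤⟨ ℚ.+-monoˡ-≤ (ℚ.- (lower k ℚ.* d)) (upper-dominates k (stage x k)) ⟩
          (lower k ℚ.+ width w k) ℚ.* d ℚ.- lower k ℚ.* d
            ≡⟨ solve 3 (λ l w d → (l :+ w) :* d :- l :* d := w :* d) ≡.refl (lower k) (width w k) d ⟩
          width w k ℚ.* d                 ≤⟨ ℚ.*-monoˡ-≤-nonNeg (width w k) {{ℚ.nonNegative (0≤width 0≤w k)}}
            (ℚ.≤-trans (p≤∣p∣ d) (subst (λ r → ℚ.∣ r ∣ ℚ.≤ D) (seq-dot x x k) x²≤Dk)) ⟩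
          width w k ℚ.* D                 <⟨ ℚ.*-monoˡ-<-pos D {{ℚ.positive 0<D}} w<e ⟩
          e ℚ.* D                         ≡⟨ eD≡c ⟩
          c                               ∎)
        where
        open ℚ.≤-Reasoning
        open ℚ-Solver

      -- A vector y exceeding a late lower endpoint, taken as a constant real vector, has gap at
      -- most (width) |y|². Once the width is small against c / s this lies below the assumed gap.
      -- Everything is measured in multiples of |y|², so y need not be normalised.
      ¬gap-definite : ∀ s c → Positive s → Positive c → ¬ (∀ x → 0ℝ ≤ s * gap x + - (c * ℝLin.dot x x))
      ¬gap-definite s c (s₀ , 0<s₀ , s₀≤s) (c₀ , 0<c₀ , c₀≤c) definite =
        let (S , 0<S , s≤S)  = bounded s
            -- Half of `c₀` is spent on the width, via e = c₀ / (2 S); the other half is the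
            -- tolerance c₀ d / 2 at which `definite` is read below.
            (e , 0<e , eS≡½c₀) = divide (0<½* 0<c₀) 0<S
            (k , w<e)        = ev-witness (width→0 0≤w 0<e)
            (y , l<A)        = lower-exceeded k
            d = ℚLin.dot y y
            q = ℚLin.quad A y
            wd = width w k ℚ.* d
            x : Vector ℝ n
            x i = fromℚ (y i)
            -- The vector is fixed at stage k, but the threshold is evaluated at a later unknown
            -- stage j, so the bound has to be uniform in j.
            A-l<w : ∀ j → lower j ℚ.* d ℚ.+ (ℚ.- 1ℚ) ℚ.* q ℚ.≤ wd
            A-l<w j = 0≤q-p⇒p≤q (subst (0ℚ ℚ.≤_)
              (solve 5 (λ l l′ w d q → ((l :+ w) :- l′) :* d :+ (q :- l :* d) := w :* d :- (l′ :* d :+ con (ℚ.- 1ℚ) :* q))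
                ≡.refl (lower k) (lower j) (width w k) d q)
              (ℚ.+-mono-≤ (0≤p*q (p≤q⇒0≤q-p (ℚ.<⇒≤ (lower<upper j k))) (ℚLin.dot-nonNeg y))
                (p≤q⇒0≤q-p (ℚ.<⇒≤ l<A))))
            -- From l d < q ≤ (l + w) d; cancelling the nonnegative width then shows that y is not
            -- zero.
            0<wd : 0ℚ ℚ.< wd
            0<wd = subst (0ℚ ℚ.<_)
              (solve 4 (λ l w d q → (q :- l :* d) :+ ((l :+ w) :* d :- q) := w :* d) ≡.refl (lower k) (width w k) d q)
              (ℚ.+-mono-<-≤ (p<q⇒0<q-p l<A) (p≤q⇒0≤q-p (upper-dominates k y)))
            0<d : 0ℚ ℚ.< d
            0<d = ℚ.*-cancelˡ-<-nonNeg (width w k) {{ℚ.nonNegative (0≤width 0≤w k)}}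
              (subst (ℚ._< wd) (≡.sym (ℚ.*-zeroʳ (width w k))) 0<wd)
            (j , (s₀≤sⱼ , s≤Sⱼ) , c₀≤cⱼ , 0<val) = ev-witness
              (ev-map₂ _,_ (ev-map₂ _,_ s₀≤s s≤S) (ev-map₂ _,_ c₀≤c (definite x (½ ℚ.* c₀ ℚ.* d) (0<p*q (0<½* 0<c₀) 0<d))))
            sⱼ = seq s j
            cⱼ = seq c j
        in ℚ.<-irrefl ≡.refl (begin-strict
          0ℚ
            <⟨ 0<val ⟩
          sⱼ ℚ.* seq (gap x) j ℚ.+ (ℚ.- 1ℚ) ℚ.* (cⱼ ℚ.* seq (ℝLin.dot x x) j) ℚ.+ ½ ℚ.* c₀ ℚ.* d
            ≡⟨ cong₂ (λ g d′ → sⱼ ℚ.* g ℚ.+ (ℚ.- 1ℚ) ℚ.* (cⱼ ℚ.* d′) ℚ.+ ½ ℚ.* c₀ ℚ.* d) (seq-gap x j) (seq-dot x x j) ⟩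
          sⱼ ℚ.* (lower j ℚ.* d ℚ.+ (ℚ.- 1ℚ) ℚ.* q) ℚ.+ (ℚ.- 1ℚ) ℚ.* (cⱼ ℚ.* d) ℚ.+ ½ ℚ.* c₀ ℚ.* d
            ≤⟨ ℚ.+-monoˡ-≤ (½ ℚ.* c₀ ℚ.* d) (ℚ.+-monoˡ-≤ ((ℚ.- 1ℚ) ℚ.* (cⱼ ℚ.* d)) (ℚ.≤-trans
                 (ℚ.*-monoˡ-≤-nonNeg sⱼ {{ℚ.nonNegative (ℚ.≤-trans (ℚ.<⇒≤ 0<s₀) s₀≤sⱼ)}} (A-l<w j))
                 (ℚ.*-monoʳ-≤-nonNeg wd {{ℚ.nonNegative (ℚ.<⇒≤ 0<wd)}} (ℚ.≤-trans (p≤∣p∣ sⱼ) s≤Sⱼ)))) ⟩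
          S ℚ.* wd ℚ.+ (ℚ.- 1ℚ) ℚ.* (cⱼ ℚ.* d) ℚ.+ ½ ℚ.* c₀ ℚ.* d
            ≡⟨ solve 5 (λ S w d c c₀ → S :* (w :* d) :+ con (ℚ.- 1ℚ) :* (c :* d) :+ con ½ :* c₀ :* d
                 := (w :* S :+ con ½ :* c₀ :- c) :* d) ≡.refl S (width w k) d cⱼ c₀ ⟩
          (width w k ℚ.* S ℚ.+ ½ ℚ.* c₀ ℚ.- cⱼ) ℚ.* d
            ≤⟨ ℚ.*-monoʳ-≤-nonNeg d {{ℚ.nonNegative (ℚ.<⇒≤ 0<d)}} (ℚ.+-mono-≤ (ℚ.+-monoˡ-≤ (½ ℚ.* c₀)
                 (ℚ.*-monoʳ-≤-nonNeg S {{ℚ.nonNegative (ℚ.<⇒≤ 0<S)}} (ℚ.<⇒≤ w<e))) (ℚ.neg-antimono-≤ c₀≤cⱼ)) ⟩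
          (e ℚ.* S ℚ.+ ½ ℚ.* c₀ ℚ.- c₀) ℚ.* d
            ≡⟨ cong (λ r → (r ℚ.+ ½ ℚ.* c₀ ℚ.- c₀) ℚ.* d) eS≡½c₀ ⟩
          (½ ℚ.* c₀ ℚ.+ ½ ℚ.* c₀ ℚ.- c₀) ℚ.* d
            ≡⟨ solve 2 (λ c d → (con ½ :* c :+ con ½ :* c :- c) :* d := con 0ℚ) ≡.refl c₀ d ⟩
          0ℚ ∎)
        where
        open ℚ.≤-Reasoning
        open ℚ-Solver

      threshold-eigenvalue : DoubleNegation (IsEigenvalue L threshold)
      threshold-eigenvalue = ¬¬-map (λ where
          (ℝLin.negative x p) → contradiction
            (Positive-resp { - ℝLin.quad (threshold ℝLin.I- L) x} { - gap x} (CommutativeRing.-‿cong ℝ-ring {ℝLin.quad (threshold ℝLin.I- L) x} {gap x} (ℝLin.quad-I- threshold L x)) p) (¬gap<0 x)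
          (ℝLin.definite s c s>0 c>0 M≥c) → contradiction
            (λ x → ℝLin.definite-I- s c threshold L x (M≥c x))
            (¬gap-definite s c s>0 c>0)
          (ℝLin.degenerate _ _ _ v v≠0 Mv≈0) → v ,
            (λ v≈0 → ¬Positive-0 (Positive-resp {ℝLin.dot v v} {0ℝ} (ℝLin.dot-zeroʳ v v v≈0) v≠0)) ,
            ℝLin.kernel⇒eigenvector threshold L v Mv≈0)
        (ℝLin.Elimination.definiteness ¬¬-Monad ℝ-sign (threshold ℝLin.I- L) (ℝLin.I--symmetric threshold {L} L-sym))
        where
        L-sym : ℝLin.Symmetric L
        L-sym i j = pointwise (L i j) (L j i) λ k →
          ≡.trans (L≡A i j k) (≡.trans (A-sym i j) (≡.sym (L≡A j i k)))
        ¬Positive-0 : ¬ Positive 0ℝ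
        ¬Positive-0 (c , 0<c , c≤0) = ℚ.<-irrefl ≡.refl (ℚ.<-≤-trans 0<c (proj₂ (ev-witness c≤0)))

-- Stability and the Rayleigh bound

≤-trans : ∀ x y z → x ≤ y → y ≤ z → x ≤ z
≤-trans x y z x≤y y≤z e 0<e = ev-map₂ (λ {n} p q → ℚ.<-trans p (subst (seq y n ℚ.+ ½ ℚ.* e ℚ.<_)
    (≡.trans (ℚ.+-assoc (seq z n) (½ ℚ.* e) (½ ℚ.* e)) (cong (seq z n ℚ.+_) (halves e)))
    (ℚ.+-monoˡ-< (½ ℚ.* e) q)))
  (x≤y _ (0<½* 0<e)) (y≤z _ (0<½* 0<e))

-- Comparing `p` with a single term of `y` is decidable, so the double negation can be removed
-- there. The Cauchy modulus then carries the comparison to all later terms within the remaining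
-- tolerance.
fromℚ≤-stable : ∀ p y → DoubleNegation (fromℚ p ≤ y) → fromℚ p ≤ y
fromℚ≤-stable p y ¬¬p≤y e 0<e =
  let r = ½ ℚ.* e
      0<r = 0<½* 0<e
      (N , close) = cauchy y (½ ℚ.* r) (0<½* 0<r)
      p<yN+r : p ℚ.< seq y N ℚ.+ r
      p<yN+r = ℚ.≰⇒> λ yN+r≤p → ¬¬p≤y λ p≤y →
        let (n , N≤n , p<yn) = ev-witness (ev-map₂ _,_ (N , λ _ N≤n → N≤n) (p≤y (½ ℚ.* r) (0<½* 0<r)))
        in ℚ.<-irrefl ≡.refl (begin-strict
          p                                   <⟨ p<yn ⟩
          seq y n ℚ.+ ½ ℚ.* r                 <⟨ ℚ.+-monoˡ-< (½ ℚ.* r) (∣p-q∣<e⇒p<q+e (seq y n) (seq y N) (close n N N≤n ℕ.≤-refl)) ⟩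
          seq y N ℚ.+ ½ ℚ.* r ℚ.+ ½ ℚ.* r     ≡⟨ ℚ.+-assoc (seq y N) (½ ℚ.* r) (½ ℚ.* r) ⟩
          seq y N ℚ.+ (½ ℚ.* r ℚ.+ ½ ℚ.* r)   ≡⟨ cong (seq y N ℚ.+_) (halves r) ⟩
          seq y N ℚ.+ r                       ≤⟨ yN+r≤p ⟩
          p                                   ∎)
  in N , λ n N≤n → begin-strict
    p                                        <⟨ p<yN+r ⟩
    seq y N ℚ.+ r                            <⟨ ℚ.+-monoˡ-< r (∣p-q∣<e⇒q<p+e (seq y n) (seq y N) (close n N N≤n ℕ.≤-refl)) ⟩
    seq y n ℚ.+ ½ ℚ.* r ℚ.+ r                ≤⟨ ℚ.+-monoˡ-≤ r (ℚ.+-monoʳ-≤ (seq y n) (proj₁ (width-bound (ℚ.<⇒≤ 0<r) 1))) ⟩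
    seq y n ℚ.+ r ℚ.+ r                      ≡⟨ ℚ.+-assoc (seq y n) r r ⟩
    seq y n ℚ.+ (r ℚ.+ r)                    ≡⟨ cong (seq y n ℚ.+_) (halves e) ⟩
    seq y n ℚ.+ e                            ∎
  where open ℚ.≤-Reasoning

-- The eigenvalue compared with `q` is the threshold. It is at least `p` because every upper
-- endpoint dominates at the given vector `x`, so that `p` is at most each lower endpoint plus a
-- width tending to zero.
rayleigh : ∀ {n} (A : ℚLin.Mat n) → ℚLin.Symmetric A →
  (L : Matrix n) → (∀ i j k → seq (L i j) k ≡ A i j) →
  ∀ q → IsLargestEigenvalue L q →
  ∀ x p → 0ℚ ℚ.< ℚLin.dot x x → p ℚ.* ℚLin.dot x x ℚ.≤ ℚLin.quad A x → fromℚ p ≤ q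
rayleigh A A-sym L L≡A q (_ , q-largest) x p 0<x² px²≤A = fromℚ≤-stable p q
  (¬¬-map (λ eigen → ≤-trans (fromℚ p) threshold q p≤threshold (q-largest threshold eigen))
    (threshold-eigenvalue L L≡A))
  where
  open ℚ-Solver
  h = proj₁ (ℚLin.quad-bound A A-sym)
  h-dominates : Dominates A A-sym h
  h-dominates y = 0≤q-p⇒p≤q (proj₂ (proj₂ (ℚLin.quad-bound A A-sym)) y)
  -- `Exceeded` is strict while `p` may be attained exactly; lowering it by 1 gives a valid left
  -- endpoint.
  p-1-exceeded : Exceeded A A-sym (p ℚ.- 1ℚ)
  p-1-exceeded = x , ℚ.<-≤-trans (ℚ.*-monoˡ-<-pos (ℚLin.dot x x) {{ℚ.positive 0<x²}}
    (0<q-p⇒p<q {p ℚ.- 1ℚ} {p} (subst (0ℚ ℚ.<_) (solve 1 (λ p → con 1ℚ := p :- (p :- con 1ℚ)) ≡.refl p) (ℚ.positive⁻¹ 1ℚ)))) px²≤A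
  w = h ℚ.- (p ℚ.- 1ℚ)
  0≤w : 0ℚ ℚ.≤ w
  0≤w = p≤q⇒0≤q-p (ℚ.<⇒≤ (exceeded<dominates A A-sym {p ℚ.- 1ℚ} {h} p-1-exceeded h-dominates))
  open Threshold A A-sym 0≤w (p ℚ.- 1ℚ , p-1-exceeded ,
    subst (Dominates A A-sym) (solve 2 (λ h l → h := l :+ (h :- l)) ≡.refl h (p ℚ.- 1ℚ)) h-dominates)
  p≤threshold : fromℚ p ≤ threshold
  p≤threshold e 0<e = ev-map (λ {k} w<e → ℚ.≤-<-trans
    (ℚ.*-cancelʳ-≤-pos {p} {lower k ℚ.+ width w k} (ℚLin.dot x x) {{ℚ.positive 0<x²}} (ℚ.≤-trans px²≤A (upper-dominates k x)))
    (ℚ.+-monoʳ-< (lower k) w<e)) (width→0 0≤w 0<e)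

-- Degrees and edges

open import Data.List.Base using ([]; _∷_)

private variable
  X : Set
  n : ℕ

-- Sums over filtered lists and over ordered pairs

when : Bool → ℚ → ℚ
when b p = if b then p else 0ℚ

Σᴸ : (X → ℚ) → List X → ℚ
Σᴸ f xs = List.foldr ℚ._+_ 0ℚ (List.map f xs)

Σᴸ-++ : ∀ (f : X → ℚ) xs ys → Σᴸ f (xs ++ ys) ≡ Σᴸ f xs ℚ.+ Σᴸ f ys
Σᴸ-++ f []       ys = ≡.sym (ℚ.+-identityˡ _)
Σᴸ-++ f (x ∷ xs) ys = ≡.trans (cong (f x ℚ.+_) (Σᴸ-++ f xs ys)) (≡.sym (ℚ.+-assoc (f x) _ _))

⌜length⌝ : ∀ (xs : List X) → ⌜ length xs ⌝ ≡ Σᴸ (λ _ → 1ℚ) xs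
⌜length⌝ []       = ≡.refl
⌜length⌝ (x ∷ xs) = ≡.trans (⌜⌝-+ 1 (length xs)) (cong (1ℚ ℚ.+_) (⌜length⌝ xs))

Σᴸ-filter-∷ : ∀ (f : X → ℚ) {P : Pred X 0ℓ} (P? : Decidable P) x xs →
  Σᴸ f (filter P? (x ∷ xs)) ≡ when (does (P? x)) (f x) ℚ.+ Σᴸ f (filter P? xs)
Σᴸ-filter-∷ f P? x xs with does (P? x)
... | true  = ≡.refl
... | false = ≡.sym (ℚ.+-identityˡ _)

Σᴸ-filter-tabulate : ∀ (f : X → ℚ) {P : Pred X 0ℓ} (P? : Decidable P) (g : Fin n → X) →
  Σᴸ f (filter P? (tabulate g)) ≡ ℚLin.sum (λ i → when (does (P? (g i))) (f (g i)))
Σᴸ-filter-tabulate {n = zero}  f P? g = ≡.refl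
Σᴸ-filter-tabulate {n = suc n} f P? g = ≡.trans (Σᴸ-filter-∷ f P? (g zero) (tabulate (g ∘ suc)))
  (cong (when (does (P? (g zero))) (f (g zero)) ℚ.+_) (Σᴸ-filter-tabulate f P? (g ∘ suc)))

∬ : (Fin n → Fin n → ℚ) → ℚ
∬ F = ℚLin.sum λ i → ℚLin.sum λ j → F i j

-- The first factor is a general `tabulate g` because the tail of `allFin` is not of the form
-- `allFin`; the induction shifts `g` and leaves the second factor alone.
Σᴸ-filter-product : ∀ {m n} (f : Fin m × Fin n → ℚ) {P : Pred (Fin m × Fin n) 0ℓ} (P? : Decidable P) {k} (g : Fin k → Fin m) →
  Σᴸ f (filter P? (cartesianProduct (tabulate g) (allFin n)))
    ≡ ℚLin.sum λ i → ℚLin.sum λ j → when (does (P? (g i , j))) (f (g i , j))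
Σᴸ-filter-product f P? {zero}  g = ≡.refl
Σᴸ-filter-product {n = n} f P? {suc k} g = begin
  Σᴸ f (filter P? (List.map (g zero ,_) (allFin n) ++ rest))
    ≡⟨ cong (Σᴸ f) (List.filter-++ P? (List.map (g zero ,_) (allFin n)) rest) ⟩
  Σᴸ f (filter P? (List.map (g zero ,_) (allFin n)) ++ filter P? rest)
    ≡⟨ Σᴸ-++ f (filter P? (List.map (g zero ,_) (allFin n))) (filter P? rest) ⟩
  Σᴸ f (filter P? (List.map (g zero ,_) (allFin n))) ℚ.+ Σᴸ f (filter P? rest)
    ≡⟨ cong₂ ℚ._+_
         (≡.trans (cong (Σᴸ f ∘ filter P?) (List.map-tabulate (λ j → j) (g zero ,_)))
           (Σᴸ-filter-tabulate f P? (g zero ,_)))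
         (Σᴸ-filter-product f P? (g ∘ suc)) ⟩
  ℚLin.sum (λ i → ℚLin.sum λ j → when (does (P? (g i , j))) (f (g i , j))) ∎
  where
  open ≡.≡-Reasoning
  rest = cartesianProduct (tabulate (g ∘ suc)) (allFin n)

Σᴸ-mono : ∀ {f g : X → ℚ} → (∀ x → f x ℚ.≤ g x) → ∀ xs → Σᴸ f xs ℚ.≤ Σᴸ g xs
Σᴸ-mono f≤g []       = ℚ.≤-refl
Σᴸ-mono f≤g (x ∷ xs) = ℚ.+-mono-≤ (f≤g x) (Σᴸ-mono f≤g xs)

Σᴸ-double : ∀ (f : X → ℚ) xs → Σᴸ (λ x → f x ℚ.+ f x) xs ≡ Σᴸ f xs ℚ.+ Σᴸ f xs
Σᴸ-double f []       = ≡.refl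
Σᴸ-double f (x ∷ xs) = ≡.trans (cong (f x ℚ.+ f x ℚ.+_) (Σᴸ-double f xs))
  (solve 2 (λ a s → (a :+ a) :+ (s :+ s) := (a :+ s) :+ (a :+ s)) ≡.refl (f x) (Σᴸ f xs))
  where open ℚ-Solver

sum-mono : ∀ {f g : Vector ℚ n} → (∀ i → f i ℚ.≤ g i) → ℚLin.sum f ℚ.≤ ℚLin.sum g
sum-mono {zero}  f≤g = ℚ.≤-refl
sum-mono {suc n} f≤g = ℚ.+-mono-≤ (f≤g zero) (sum-mono (f≤g ∘ suc))

∬-cong : ∀ {F G : Fin n → Fin n → ℚ} → (∀ i j → F i j ≡ G i j) → ∬ F ≡ ∬ G
∬-cong F≡G = ℚLin.sum-cong-≋ λ i → ℚLin.sum-cong-≋ (F≡G i)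

∬-+ : ∀ (F G : Fin n → Fin n → ℚ) → ∬ (λ i j → F i j ℚ.+ G i j) ≡ ∬ F ℚ.+ ∬ G
∬-+ F G = ≡.trans (ℚLin.sum-cong-≋ λ i → ℚLin.∑-distrib-+ (F i) (G i))
  (ℚLin.∑-distrib-+ (λ i → ℚLin.sum (F i)) (λ i → ℚLin.sum (G i)))

∬-* : ∀ p (F : Fin n → Fin n → ℚ) → ∬ (λ i j → p ℚ.* F i j) ≡ p ℚ.* ∬ F
∬-* p F = ≡.trans (ℚLin.sum-cong-≋ λ i → ≡.sym (ℚLin.*-distribˡ-sum p (F i)))
  (≡.sym (ℚLin.*-distribˡ-sum p (λ i → ℚLin.sum (F i))))

∬-nonNeg : ∀ {F : Fin n → Fin n → ℚ} → (∀ i j → 0ℚ ℚ.≤ F i j) → 0ℚ ℚ.≤ ∬ F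
∬-nonNeg 0≤F = sum-nonNeg λ i → sum-nonNeg (0≤F i)
  where
  sum-nonNeg : ∀ {n} {f : Vector ℚ n} → (∀ i → 0ℚ ℚ.≤ f i) → 0ℚ ℚ.≤ ℚLin.sum f
  sum-nonNeg {zero}  0≤f = ℚ.≤-refl
  sum-nonNeg {suc n} 0≤f = ℚ.+-mono-≤ (0≤f zero) (sum-nonNeg (0≤f ∘ suc))

reciprocal : ∀ k .{{_ : NonZero k}} → ⌜ k ⌝ ℚ.* (+ 1 ℚ./ k) ≡ 1ℚ
reciprocal (suc k) = ℚ.toℚᵘ-injective (begin
  ℚ.toℚᵘ (⌜ suc k ⌝ ℚ.* (+ 1 ℚ./ suc k))
    ≈⟨ ℚ.toℚᵘ-homo-* ⌜ suc k ⌝ (+ 1 ℚ./ suc k) ⟩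
  ℚ.toℚᵘ ⌜ suc k ⌝ ℚᵘ.* ℚ.toℚᵘ (+ 1 ℚ./ suc k)
    ≈⟨ ℚᵘ.*-cong (toℚᵘ-⌜⌝ (suc k)) (ℚ.toℚᵘ-fromℚᵘ (mkℚᵘ (+ 1) k)) ⟩
  mkℚᵘ (+ suc k) 0 ℚᵘ.* mkℚᵘ (+ 1) k
    ≈⟨ ℚᵘ.*≡* (cong +_ (≡.trans (ℕ.*-identityʳ (suc k ℕ.* 1)) (≡.trans (ℕ.*-identityʳ (suc k))
         (≡.sym (≡.trans (ℕ.*-identityˡ (1 ℕ.* suc k)) (ℕ.*-identityˡ (suc k))))))) ⟩
  ℚ.toℚᵘ 1ℚ ∎)
  where open ℚᵘ.≃-Reasoning

0≤⌜⌝ : ∀ k → 0ℚ ℚ.≤ ⌜ k ⌝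
0≤⌜⌝ k = ⌜⌝-mono {0} {k} ℕ.z≤n

-- The approximation s rounds down, so s² ≤ x y and the inequality of means holds at every stage
-- without error. If 2 s > x + y, then (2 s)² - (x + y)², 4 (x y - s²) and (x - y)² would have a
-- positive sum, yet they add up to zero.
am-gm : ∀ x y k → √-approx (x ℕ.* y) k ℚ.+ √-approx (x ℕ.* y) k ℚ.≤ ⌜ x ⌝ ℚ.+ ⌜ y ⌝
am-gm x y k = ℚ.≮⇒≥ λ x+y<2s → ℚ.<-irrefl ≡.refl (subst (0ℚ ℚ.<_)
  (solve 3 (λ s x y → ((s :+ s) :- (x :+ y)) :* ((s :+ s) :+ (x :+ y))
      :+ (con 4ℚ :* (x :* y :- s :* s) :+ (x :- y) :* (x :- y)) := con 0ℚ) ≡.refl s ⌜ x ⌝ ⌜ y ⌝)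
  (ℚ.+-mono-<-≤
    (0<p*q (p<q⇒0<q-p x+y<2s)
      (ℚ.+-mono-<-≤ (ℚ.≤-<-trans 0≤x+y x+y<2s) 0≤x+y))
    (ℚ.+-mono-≤ (0≤p*q (ℚ.nonNegative⁻¹ 4ℚ) (p≤q⇒0≤q-p s²≤xy)) (0≤p*p (⌜ x ⌝ ℚ.- ⌜ y ⌝)))))
  where
  open ℚ-Solver
  4ℚ = + 4 ℚ./ 1
  s = √-approx (x ℕ.* y) k
  0≤x+y : 0ℚ ℚ.≤ ⌜ x ⌝ ℚ.+ ⌜ y ⌝
  0≤x+y = ℚ.+-mono-≤ (0≤⌜⌝ x) (0≤⌜⌝ y)
  s²≤xy : s ℚ.* s ℚ.≤ ⌜ x ⌝ ℚ.* ⌜ y ⌝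
  s²≤xy = subst (s ℚ.* s ℚ.≤_) (⌜⌝-* x y) (√-approx-lower (x ℕ.* y) k)

-- Adjacency sums and the quadratic form at the degree vector

module _ (G : SimpleGraph n) where

  open SimpleGraph G

  a : Fin n → Fin n → ℚ
  a i j = when (adjacent i j) 1ℚ

  d : Fin n → ℚ
  d i = ⌜ degree G i ⌝

  D m : ℚ
  D = ℚLin.dot d d
  m = ⌜ ∣E∣ G ⌝

  a-symmetric : ∀ i j → a i j ≡ a j i
  a-symmetric i j = cong (λ b → when b 1ℚ) (symmetric i j)

  0≤a : ∀ i j → 0ℚ ℚ.≤ a i j
  0≤a i j with adjacent i j
  ... | true  = ℚ.nonNegative⁻¹ 1ℚ
  ... | false = ℚ.≤-refl

  sum-a : ∀ i → ℚLin.sum (a i) ≡ d i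
  sum-a i = ≡.sym (≡.trans (⌜length⌝ (filter (λ j → T? (adjacent i j)) (allFin n)))
    (Σᴸ-filter-tabulate (λ _ → 1ℚ) (λ j → T? (adjacent i j)) (λ j → j)))

  ∬-row : ∀ (g : Vector ℚ n) → ∬ (λ i j → a i j ℚ.* g i) ≡ ℚLin.dot d g
  ∬-row g = ℚLin.sum-cong-≋ λ i → ≡.trans (ℚLin.sum-cong-≋ λ j → ℚ.*-comm (a i j) (g i))
    (≡.trans (≡.sym (ℚLin.*-distribˡ-sum (g i) (a i))) (≡.trans (cong (g i ℚ.*_) (sum-a i)) (ℚ.*-comm (g i) (d i))))

  ∬-swap : ∀ (F : Fin n → Fin n → ℚ) → ∬ (λ i j → a i j ℚ.* F i j) ≡ ∬ (λ i j → a i j ℚ.* F j i)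
  ∬-swap F = ≡.trans (ℚLin.∑-comm (λ i j → a i j ℚ.* F i j))
    (∬-cong λ j i → cong (ℚ._* F i j) (a-symmetric i j))

  -- Edges are listed with i < j, so by trichotomy each off-diagonal entry of the ordered sum
  -- matches exactly one of F i j and F j i, and irreflexivity removes the diagonal. Ordered sums
  -- are preferred elsewhere because their indices can be exchanged freely.
  edge-sum : ∀ (f : Fin n → Fin n → ℚ) → (∀ i j → f i j ≡ f j i) →
    ∬ (λ i j → a i j ℚ.* f i j) ≡ Σᴸ (λ (i , j) → f i j) (edges G) ℚ.+ Σᴸ (λ (i , j) → f i j) (edges G)
  edge-sum f f-sym = begin
    ∬ (λ i j → a i j ℚ.* f i j)             ≡⟨ ∬-cong split ⟩
    ∬ (λ i j → F i j ℚ.+ F j i)             ≡⟨ ∬-+ F (λ i j → F j i) ⟩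
    ∬ F ℚ.+ ∬ (λ i j → F j i)               ≡⟨ cong (∬ F ℚ.+_) (ℚLin.∑-comm (λ i j → F j i)) ⟩
    ∬ F ℚ.+ ∬ F                             ≡⟨ cong₂ ℚ._+_ ∬F ∬F ⟨
    Σᴸ _ (edges G) ℚ.+ Σᴸ _ (edges G)       ∎
    where
    open ≡.≡-Reasoning
    F : Fin n → Fin n → ℚ
    F i j = when (does (i Fin.<? j) ∧ adjacent i j) (f i j)
    ∬F : Σᴸ (λ (i , j) → f i j) (edges G) ≡ ∬ F
    ∬F = Σᴸ-filter-product (λ (i , j) → f i j) _ (λ i → i)
    value : ∀ b p → when b 1ℚ ℚ.* p ≡ when b p
    value true  p = ℚ.*-identityˡ p
    value false p = ℚ.*-zeroˡ p
    split : ∀ i j → a i j ℚ.* f i j ≡ F i j ℚ.+ F j i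
    split i j with Fin.<-cmp i j
    ... | tri< i<j _ j≮i rewrite dec-true (i Fin.<? j) i<j | dec-false (j Fin.<? i) j≮i =
      ≡.trans (value (adjacent i j) (f i j)) (≡.sym (ℚ.+-identityʳ _))
    ... | tri> i≮j _ j<i rewrite dec-true (j Fin.<? i) j<i | dec-false (i Fin.<? j) i≮j =
      ≡.trans (≡.trans (value (adjacent i j) (f i j)) (cong₂ when (symmetric i j) (f-sym i j))) (≡.sym (ℚ.+-identityˡ _))
    ... | tri≈ i≮j ≡.refl j≮i rewrite dec-false (i Fin.<? i) i≮j | irreflexive i = ℚ.*-zeroˡ (f i i)

  ∬-a : ∬ a ≡ m ℚ.+ m
  ∬-a = ≡.trans (∬-cong λ i j → ≡.sym (ℚ.*-identityʳ (a i j)))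
    (≡.trans (edge-sum (λ _ _ → 1ℚ) (λ _ _ → ≡.refl))
      (≡.sym (cong₂ ℚ._+_ (⌜length⌝ (edges G)) (⌜length⌝ (edges G)))))

  edge-degrees : Σᴸ (λ (i , j) → d i ℚ.+ d j) (edges G) ≡ D
  edge-degrees = begin
    S                   ≡⟨ halve S ⟨
    ½ ℚ.* (S ℚ.+ S)     ≡⟨ cong (½ ℚ.*_) (edge-sum (λ i j → d i ℚ.+ d j) (λ i j → ℚ.+-comm (d i) (d j))) ⟨
    ½ ℚ.* ∬ (λ i j → a i j ℚ.* (d i ℚ.+ d j))
      ≡⟨ cong (½ ℚ.*_) (∬-cong λ i j → ℚ.*-distribˡ-+ (a i j) (d i) (d j)) ⟩
    ½ ℚ.* ∬ (λ i j → a i j ℚ.* d i ℚ.+ a i j ℚ.* d j)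
      ≡⟨ cong (½ ℚ.*_) (∬-+ (λ i j → a i j ℚ.* d i) (λ i j → a i j ℚ.* d j)) ⟩
    ½ ℚ.* (∬ (λ i j → a i j ℚ.* d i) ℚ.+ ∬ (λ i j → a i j ℚ.* d j))
      ≡⟨ cong (½ ℚ.*_) (cong₂ ℚ._+_ (∬-row d) (≡.trans (∬-swap (λ i j → d j)) (∬-row d))) ⟩
    ½ ℚ.* (D ℚ.+ D)     ≡⟨ halve D ⟩
    D                   ∎
    where
    open ≡.≡-Reasoning
    open ℚ-Solver
    S = Σᴸ (λ (i , j) → d i ℚ.+ d j) (edges G)
    halve : ∀ p → ½ ℚ.* (p ℚ.+ p) ≡ p
    halve = solve 1 (λ p → con ½ :* (p :+ p) := p) ≡.refl

  -- The signless Laplacian over ℚ; the real one has these entries as constant sequences, which is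
  -- what `rayleigh` asks for.
  A : ℚLin.Mat n
  A i j = ℚLin.diagonal d i j ℚ.+ a i j

  A-symmetric : ℚLin.Symmetric A
  A-symmetric i j = cong₂ ℚ._+_ (ℚLin.diagonal-symmetric d i j) (a-symmetric i j)

  L≡A : ∀ i j k → seq (signlessLaplacian G i j) k ≡ A i j
  L≡A i j k = cong₂ ℚ._+_ (if-float (λ x → seq x k) (does (i Fin.≟ j))) (if-float (λ x → seq x k) (adjacent i j))

  -- The diagonal contribution dᵢ² is itself a sum over neighbours, because dᵢ = ∑ⱼ aᵢⱼ.
  A-d : ∀ i → (A ℚLin.· d) i ≡ ℚLin.sum (λ j → a i j ℚ.* (d i ℚ.+ d j))
  A-d i = begin
    ℚLin.sum (λ j → (ℚLin.diagonal d i j ℚ.+ a i j) ℚ.* d j)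
      ≡⟨ ℚLin.sum-cong-≋ (λ j → ℚ.*-distribʳ-+ (d j) (ℚLin.diagonal d i j) (a i j)) ⟩
    ℚLin.sum (λ j → ℚLin.diagonal d i j ℚ.* d j ℚ.+ a i j ℚ.* d j)
      ≡⟨ ℚLin.∑-distrib-+ (λ j → ℚLin.diagonal d i j ℚ.* d j) (λ j → a i j ℚ.* d j) ⟩
    (ℚLin.diagonal d ℚLin.· d) i ℚ.+ ℚLin.sum (λ j → a i j ℚ.* d j)
      ≡⟨ cong (ℚ._+ ℚLin.sum (λ j → a i j ℚ.* d j)) (≡.trans (ℚLin.diagonal-· d d i)
           (≡.trans (cong (d i ℚ.*_) (≡.sym (sum-a i))) (≡.trans (ℚLin.*-distribˡ-sum (d i) (a i))
             (ℚLin.sum-cong-≋ λ j → ℚ.*-comm (d i) (a i j))))) ⟩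
    ℚLin.sum (λ j → a i j ℚ.* d i) ℚ.+ ℚLin.sum (λ j → a i j ℚ.* d j)
      ≡⟨ ℚLin.∑-distrib-+ (λ j → a i j ℚ.* d i) (λ j → a i j ℚ.* d j) ⟨
    ℚLin.sum (λ j → a i j ℚ.* d i ℚ.+ a i j ℚ.* d j)
      ≡⟨ ℚLin.sum-cong-≋ (λ j → ≡.sym (ℚ.*-distribˡ-+ (a i j) (d i) (d j))) ⟩
    ℚLin.sum (λ j → a i j ℚ.* (d i ℚ.+ d j)) ∎
    where open ≡.≡-Reasoning

  W : ℚ
  W = ℚLin.quad A d

  ∬-W : ∬ (λ i j → a i j ℚ.* (d i ℚ.* (d i ℚ.+ d j))) ≡ W
  ∬-W = ℚLin.sum-cong-≋ λ i → ≡.sym (≡.trans (cong (d i ℚ.*_) (A-d i))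
    (≡.trans (ℚLin.*-distribˡ-sum (d i) (λ j → a i j ℚ.* (d i ℚ.+ d j)))
      (ℚLin.sum-cong-≋ λ j → solve 3 (λ x a s → x :* (a :* s) := a :* (x :* s)) ≡.refl (d i) (a i j) (d i ℚ.+ d j))))
    where open ℚ-Solver

  -- Expand 0 ≤ ∑ᵢⱼ aᵢⱼ (m (dᵢ + dⱼ) - D)², which is 2 m (m W - D²).
  m*[mW-D²]≥0 : 0ℚ ℚ.≤ (m ℚ.+ m) ℚ.* (m ℚ.* W ℚ.- D ℚ.* D)
  m*[mW-D²]≥0 = subst (0ℚ ℚ.≤_) expand (∬-nonNeg λ i j → 0≤p*q (0≤a i j) (0≤p*p (m ℚ.* (d i ℚ.+ d j) ℚ.- D)))
    where
    open ≡.≡-Reasoning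
    open ℚ-Solver
    -- The square (dᵢ + dⱼ)² is split as dᵢ (dᵢ + dⱼ) + dⱼ (dⱼ + dᵢ), and the linear term likewise,
    -- so that exchanging i and j identifies `F₂` with `F₁` and `F₄` with `F₃` under the sum.
    F₁ F₂ F₃ F₄ : Fin n → Fin n → ℚ
    F₁ i j = a i j ℚ.* (d i ℚ.* (d i ℚ.+ d j))
    F₂ i j = a i j ℚ.* (d j ℚ.* (d j ℚ.+ d i))
    F₃ i j = a i j ℚ.* d i
    F₄ i j = a i j ℚ.* d j
    r : ℚ
    r = ℚ.- (m ℚ.* D ℚ.+ m ℚ.* D)
    expand : ∬ (λ i j → a i j ℚ.* ((m ℚ.* (d i ℚ.+ d j) ℚ.- D) ℚ.* (m ℚ.* (d i ℚ.+ d j) ℚ.- D)))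
             ≡ (m ℚ.+ m) ℚ.* (m ℚ.* W ℚ.- D ℚ.* D)
    expand = begin
      ∬ (λ i j → a i j ℚ.* ((m ℚ.* (d i ℚ.+ d j) ℚ.- D) ℚ.* (m ℚ.* (d i ℚ.+ d j) ℚ.- D)))
        ≡⟨ ∬-cong (λ i j → solve 5 (λ a m D x y →
             a :* ((m :* (x :+ y) :- D) :* (m :* (x :+ y) :- D)) :=
             ((m :* m) :* (a :* (x :* (x :+ y)) :+ a :* (y :* (y :+ x)))
               :+ (:- (m :* D :+ m :* D)) :* (a :* x :+ a :* y)) :+ (D :* D) :* a)
             ≡.refl (a i j) m D (d i) (d j)) ⟩
      ∬ (λ i j → (m ℚ.* m ℚ.* (F₁ i j ℚ.+ F₂ i j) ℚ.+ r ℚ.* (F₃ i j ℚ.+ F₄ i j)) ℚ.+ D ℚ.* D ℚ.* a i j)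
        ≡⟨ ∬-+ (λ i j → m ℚ.* m ℚ.* (F₁ i j ℚ.+ F₂ i j) ℚ.+ r ℚ.* (F₃ i j ℚ.+ F₄ i j)) (λ i j → D ℚ.* D ℚ.* a i j) ⟩
      ∬ (λ i j → m ℚ.* m ℚ.* (F₁ i j ℚ.+ F₂ i j) ℚ.+ r ℚ.* (F₃ i j ℚ.+ F₄ i j)) ℚ.+ ∬ (λ i j → D ℚ.* D ℚ.* a i j)
        ≡⟨ cong₂ ℚ._+_
             (≡.trans (∬-+ (λ i j → m ℚ.* m ℚ.* (F₁ i j ℚ.+ F₂ i j)) (λ i j → r ℚ.* (F₃ i j ℚ.+ F₄ i j)))
               (cong₂ ℚ._+_ (scaled (m ℚ.* m) F₁ F₂ ∬-W (≡.trans (≡.sym (∬-swap (λ i j → d i ℚ.* (d i ℚ.+ d j)))) ∬-W))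
                            (scaled r F₃ F₄ (∬-row d) (≡.trans (≡.sym (∬-swap (λ i j → d i))) (∬-row d)))))
             (≡.trans (∬-* (D ℚ.* D) a) (cong (D ℚ.* D ℚ.*_) ∬-a)) ⟩
      (m ℚ.* m ℚ.* (W ℚ.+ W) ℚ.+ r ℚ.* (D ℚ.+ D)) ℚ.+ D ℚ.* D ℚ.* (m ℚ.+ m)
        ≡⟨ solve 3 (λ m D W → (m :* m :* (W :+ W) :+ (:- (m :* D :+ m :* D)) :* (D :+ D)) :+ D :* D :* (m :+ m)
             := (m :+ m) :* (m :* W :- D :* D)) ≡.refl m D W ⟩
      (m ℚ.+ m) ℚ.* (m ℚ.* W ℚ.- D ℚ.* D) ∎
      where
      scaled : ∀ p F F′ {s} → ∬ F ≡ s → ∬ F′ ≡ s → ∬ (λ i j → p ℚ.* (F i j ℚ.+ F′ i j)) ≡ p ℚ.* (s ℚ.+ s)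
      scaled p F F′ F≡s F′≡s = ≡.trans (∬-* p (λ i j → F i j ℚ.+ F′ i j))
        (cong (p ℚ.*_) (≡.trans (∬-+ F F′) (cong₂ ℚ._+_ F≡s F′≡s)))

  sum-d² : ∀ k → seq (∑ λ i → fromℕ (degree G i ℕ.^ 2)) k ≡ D
  sum-d² k = ≡.trans (seq-sum (λ i → fromℕ (degree G i ℕ.^ 2)) k)
    (ℚLin.sum-cong-≋ λ i → ≡.trans (cong ⌜_⌝ (cong (degree G i ℕ.*_) (ℕ.*-identityʳ (degree G i))))
      (⌜⌝-* (degree G i) (degree G i)))

  seq-edges : ∀ (f : Fin n × Fin n → ℝ) k (xs : List (Fin n × Fin n)) →
    seq (List.foldr _+_ 0ℝ (List.map f xs)) k ≡ Σᴸ (λ e → seq (f e) k) xs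
  seq-edges f k []       = ≡.refl
  seq-edges f k (x ∷ xs) = cong (seq (f x) k ℚ.+_) (seq-edges f k xs)

  -- The two inequalities

  module _ .{{m≢0 : NonZero (∣E∣ G)}} where

    private
      instance
        4m²≢0 : NonZero (4 ℕ.* ∣E∣ G ℕ.^ 2)
        4m²≢0 = ℕ.m*n≢0 4 (∣E∣ G ℕ.^ 2) {{_}} {{ℕ.m^n≢0 (∣E∣ G) 2}}

        2m²≢0 : NonZero (2 ℕ.* ∣E∣ G ℕ.^ 2)
        2m²≢0 = ℕ.m*n≢0 2 (∣E∣ G ℕ.^ 2) {{_}} {{ℕ.m^n≢0 (∣E∣ G) 2}}

        4m≢0 : NonZero (4 ℕ.* ∣E∣ G)
        4m≢0 = ℕ.m*n≢0 4 (∣E∣ G)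

    r₂ r₄ r : ℚ
    r₂ = + 1 ℚ./ (2 ℕ.* ∣E∣ G ℕ.^ 2)
    r₄ = + 1 ℚ./ (4 ℕ.* ∣E∣ G ℕ.^ 2)
    r  = + 1 ℚ./ (4 ℕ.* ∣E∣ G)

    -- Used to bring 1/(2m²) and 1/(4m) over the denominator 4m² of ν.
    reciprocal-* : ∀ {k l j} .{{_ : NonZero k}} .{{_ : NonZero l}} → k ≡ j ℕ.* l →
                   (+ 1 ℚ./ l) ≡ ⌜ j ⌝ ℚ.* (+ 1 ℚ./ k)
    reciprocal-* {k} {l} {j} k≡jl = begin
      l⁻¹                                   ≡⟨ ℚ.*-identityʳ l⁻¹ ⟨
      l⁻¹ ℚ.* 1ℚ                            ≡⟨ cong (l⁻¹ ℚ.*_) (reciprocal k) ⟨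
      l⁻¹ ℚ.* (⌜ k ⌝ ℚ.* k⁻¹)               ≡⟨ cong (λ p → l⁻¹ ℚ.* (p ℚ.* k⁻¹)) (≡.trans (cong ⌜_⌝ k≡jl) (⌜⌝-* j l)) ⟩
      l⁻¹ ℚ.* ((⌜ j ⌝ ℚ.* ⌜ l ⌝) ℚ.* k⁻¹)   ≡⟨ solve 4 (λ L j l k → L :* ((j :* l) :* k) := (l :* L) :* (j :* k)) ≡.refl l⁻¹ ⌜ j ⌝ ⌜ l ⌝ k⁻¹ ⟩
      (⌜ l ⌝ ℚ.* l⁻¹) ℚ.* (⌜ j ⌝ ℚ.* k⁻¹)   ≡⟨ cong (ℚ._* (⌜ j ⌝ ℚ.* k⁻¹)) (reciprocal l) ⟩
      1ℚ ℚ.* (⌜ j ⌝ ℚ.* k⁻¹)                ≡⟨ ℚ.*-identityˡ _ ⟩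
      ⌜ j ⌝ ℚ.* k⁻¹                         ∎
      where
      open ≡.≡-Reasoning
      open ℚ-Solver
      k⁻¹ = + 1 ℚ./ k
      l⁻¹ = + 1 ℚ./ l

    r₂≡2r₄ : r₂ ≡ ⌜ 2 ⌝ ℚ.* r₄
    r₂≡2r₄ = reciprocal-* {4 ℕ.* ∣E∣ G ℕ.^ 2} {2 ℕ.* ∣E∣ G ℕ.^ 2} {2} (ℕ.*-assoc 2 2 (∣E∣ G ℕ.^ 2))

    r≡mr₄ : r ≡ m ℚ.* r₄
    r≡mr₄ = reciprocal-* {4 ℕ.* ∣E∣ G ℕ.^ 2} {4 ℕ.* ∣E∣ G} {∣E∣ G} (begin
      4 ℕ.* ∣E∣ G ℕ.^ 2           ≡⟨ cong (λ k → 4 ℕ.* (∣E∣ G ℕ.* k)) (ℕ.*-identityʳ (∣E∣ G)) ⟩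
      4 ℕ.* (∣E∣ G ℕ.* ∣E∣ G)     ≡⟨ ℕ.*-assoc 4 (∣E∣ G) (∣E∣ G) ⟨
      4 ℕ.* ∣E∣ G ℕ.* ∣E∣ G       ≡⟨ ℕ.*-comm (4 ℕ.* ∣E∣ G) (∣E∣ G) ⟩
      ∣E∣ G ℕ.* (4 ℕ.* ∣E∣ G)     ∎)
      where open ≡.≡-Reasoning

    0<m : 0ℚ ℚ.< m
    0<m = ℚ.<-≤-trans (ℚ.positive⁻¹ 1ℚ) (⌜⌝-mono (ℕ.>-nonZero⁻¹ (∣E∣ G)))

    0≤reciprocal : ∀ k .{{_ : NonZero k}} → 0ℚ ℚ.≤ + 1 ℚ./ k
    0≤reciprocal k = ℚ.nonNegative⁻¹ _ {{ℚ.normalize-nonNeg 1 k}}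

    seq-ν : ∀ k → seq (ν G) k ≡ ⌜ n ⌝ ℚ.* D ℚ.* r₄
    seq-ν k = cong (λ s → ⌜ n ⌝ ℚ.* s ℚ.* r₄) (sum-d² k)

    -- The comparison already holds between the k-th terms for every k; the tolerance `e` only makes
    -- it strict.
    ε≤ν : ε G ≤ ν G
    ε≤ν e 0<e = always λ k → begin-strict
      seq (ε G) k
        ≡⟨ cong (λ s → ⌜ n ⌝ ℚ.* s ℚ.* r₂) (seq-edges (λ (i , j) → √ (degree G i ℕ.* degree G j)) k (edges G)) ⟩
      ⌜ n ⌝ ℚ.* S k ℚ.* r₂
        ≡⟨ cong (⌜ n ⌝ ℚ.* S k ℚ.*_) r₂≡2r₄ ⟩
      ⌜ n ⌝ ℚ.* S k ℚ.* (⌜ 2 ⌝ ℚ.* r₄)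
        ≡⟨ solve 3 (λ n s r → n :* s :* (con (+ 2 ℚ./ 1) :* r) := n :* (s :+ s) :* r) ≡.refl ⌜ n ⌝ (S k) r₄ ⟩
      ⌜ n ⌝ ℚ.* (S k ℚ.+ S k) ℚ.* r₄
        ≤⟨ ℚ.*-monoʳ-≤-nonNeg r₄ {{ℚ.nonNegative (0≤reciprocal (4 ℕ.* ∣E∣ G ℕ.^ 2))}}
             (ℚ.*-monoˡ-≤-nonNeg ⌜ n ⌝ {{ℚ.nonNegative (0≤⌜⌝ n)}} (2S≤D k)) ⟩
      ⌜ n ⌝ ℚ.* D ℚ.* r₄
        ≡⟨ seq-ν k ⟨
      seq (ν G) k
        ≡⟨ ℚ.+-identityʳ (seq (ν G) k) ⟨
      seq (ν G) k ℚ.+ 0ℚ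
        <⟨ ℚ.+-monoʳ-< (seq (ν G) k) 0<e ⟩
      seq (ν G) k ℚ.+ e ∎
      where
      open ℚ.≤-Reasoning
      open ℚ-Solver
      S : ℕ → ℚ
      S k = Σᴸ (λ (i , j) → √-approx (degree G i ℕ.* degree G j) k) (edges G)
      2S≤D : ∀ k → S k ℚ.+ S k ℚ.≤ D
      2S≤D k = subst₂ ℚ._≤_ (Σᴸ-double (λ (i , j) → √-approx (degree G i ℕ.* degree G j) k) (edges G)) edge-degrees
        (Σᴸ-mono (λ (i , j) → am-gm (degree G i) (degree G j) k) (edges G))

    D²≤mW : D ℚ.* D ℚ.≤ m ℚ.* W
    D²≤mW = 0≤q-p⇒p≤q (0≤s*p⇒0≤p (m ℚ.+ m) (m ℚ.* W ℚ.- D ℚ.* D) (ℚ.+-mono-< 0<m 0<m) m*[mW-D²]≥0)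

    -- Degrees are natural numbers, so dᵢ ≤ dᵢ² and D ≥ ∑ dᵢ = 2 m. This makes the degree vector
    -- admissible for `rayleigh`.
    0<D : 0ℚ ℚ.< D
    0<D = ℚ.<-≤-trans (ℚ.+-mono-< 0<m 0<m) (subst (ℚ._≤ D) (≡.trans (ℚLin.sum-cong-≋ (λ i → ≡.sym (sum-a i))) ∬-a)
      (sum-mono λ i → subst (d i ℚ.≤_) (⌜⌝-* (degree G i) (degree G i)) (⌜⌝-mono (m≤m*m (degree G i)))))
      where
      m≤m*m : ∀ k → k ℕ.≤ k ℕ.* k
      m≤m*m zero    = ℕ.z≤n
      m≤m*m (suc k) = ℕ.m≤m*n (suc k) (suc k)

    ν≤γ : ∀ q → IsLargestEigenvalue (signlessLaplacian G) q → ν G ≤ γ G q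
    ν≤γ q largest e 0<e =
      let (p , 0<p , pm≡D) = divide 0<D 0<m
          c = ⌜ n ⌝ ℚ.* r
          0≤c = 0≤p*q (0≤⌜⌝ n) (0≤reciprocal (4 ℕ.* ∣E∣ G))
          0<c+1 = ℚ.+-mono-≤-< 0≤c (ℚ.positive⁻¹ 1ℚ)
          -- The part δ c absorbs the error of p ≤ q after scaling by c; the extra δ gives
          -- strictness and keeps the divisor positive.
          (δ , 0<δ , δ[c+1]≡e) = divide 0<e 0<c+1
          -- This is D² ≤ m W with one factor D replaced by p m and m cancelled.
          pD≤W : p ℚ.* D ℚ.≤ W
          pD≤W = ℚ.*-cancelˡ-≤-pos m {{ℚ.positive 0<m}} (subst (ℚ._≤ m ℚ.* W)
            (≡.trans (cong (ℚ._* D) (≡.sym pm≡D)) (solve 3 (λ p m D → p :* m :* D := m :* (p :* D)) ≡.refl p m D)) D²≤mW)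
          p≤q = rayleigh A A-symmetric (signlessLaplacian G) L≡A q largest d p 0<D pD≤W
      in ev-map (λ {k} p<q+δ → begin-strict
        seq (ν G) k                               ≡⟨ seq-ν k ⟩
        ⌜ n ⌝ ℚ.* D ℚ.* r₄                        ≡⟨ cong (λ D → ⌜ n ⌝ ℚ.* D ℚ.* r₄) pm≡D ⟨
        ⌜ n ⌝ ℚ.* (p ℚ.* m) ℚ.* r₄                ≡⟨ solve 4 (λ n p m r → n :* (p :* m) :* r := p :* (n :* (m :* r))) ≡.refl ⌜ n ⌝ p m r₄ ⟩
        p ℚ.* (⌜ n ⌝ ℚ.* (m ℚ.* r₄))              ≡⟨ cong (λ r → p ℚ.* (⌜ n ⌝ ℚ.* r)) r≡mr₄ ⟨
        p ℚ.* c                                   ≤⟨ ℚ.*-monoʳ-≤-nonNeg c {{ℚ.nonNegative 0≤c}} (ℚ.<⇒≤ p<q+δ) ⟩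
        (seq q k ℚ.+ δ) ℚ.* c                     ≡⟨ ℚ.+-identityʳ _ ⟨
        (seq q k ℚ.+ δ) ℚ.* c ℚ.+ 0ℚ              <⟨ ℚ.+-monoʳ-< ((seq q k ℚ.+ δ) ℚ.* c) 0<δ ⟩
        (seq q k ℚ.+ δ) ℚ.* c ℚ.+ δ               ≡⟨ solve 4 (λ q δ n r → (q :+ δ) :* (n :* r) :+ δ := q :* n :* r :+ δ :* (n :* r :+ con 1ℚ)) ≡.refl (seq q k) δ ⌜ n ⌝ r ⟩
        seq q k ℚ.* ⌜ n ⌝ ℚ.* r ℚ.+ δ ℚ.* (c ℚ.+ 1ℚ) ≡⟨ cong (seq q k ℚ.* ⌜ n ⌝ ℚ.* r ℚ.+_) δ[c+1]≡e ⟩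
        seq (γ G q) k ℚ.+ e                       ∎) (p≤q δ 0<δ)
      where
      open ℚ.≤-Reasoning
      open ℚ-Solver

mainTheorem8 : (n : ℕ) (G : SimpleGraph n) .{{_ : NonZero (∣E∣ G)}}
    (q : ℝ) → IsLargestEigenvalue (signlessLaplacian G) q →
    (ν G ≥ ε G) × (γ G q ≥ ν G)
mainTheorem8 n G q largest = ε≤ν G , ν≤γ G q largest
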